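{- For each of the six finite directed graphs $G \in \{4(1,1),\ 4(2),\ 6(1,1),\ 6(2),\ 6(3),\ 8(2,1,1)\}$ (described explicitly in the context), there exist infinitely many parameters $c \in \mathbb{Q}$ such that the directed graph $\mathrm{PrePer}(f_c, \mathbb{Q})$ of rational preperiodic points of $f_c(z) = z^2 + c$ is isomorphic to $G$.
   Context: For $c \in \mathbb{Q}$ let $f_c(z) = z^2 + c$. $\mathrm{PrePer}(f_c,\mathbb{Q})$ is the set of $x \in \mathbb{Q}$ whose forward orbit under iteration of $f_c$ is finite. It is regarded as a directed graph with an arrow $x \to f_c(x)$ for every $x \in \mathrm{PrePer}(f_c,\mathbb{Q})$ (so a fixed point carries a loop). Isomorphism means isomorphism of directed graphs. The notation $N(\ell_1,\ell_2,\ldots)$ denotes a graph with $N$ vertices and directed cycles of lengths $\ell_1,\ell_2,\ldots$. The six graphs are the following (every vertex has exactly one outgoing arrow, and all arrows are listed): - $4(1,1)$: vertices $a,a',b,b'$; arrows $a\to a$, $a'\to a$, $b\to b$, $b'\to b$. - $4(2)$: vertices $x,y,x',y'$; arrows $x\to y$, $y\to x$, $x'\to y$, $y'\to x$. - $6(1,1)$: vertices $a,a',b,b',u,u'$; arrows $a\to a$, $a'\to a$, $b\to b$, $b'\to b$, $u\to a'$, $u'\to a'$. - $6(2)$: vertices $x,y,x',y',u,u'$; arrows $x\to y$, $y\to x$, $x'\to y$, $y'\to x$, $u\to x'$, $u'\to x'$. - $6(3)$: vertices $x,y,z,x',y',z'$; arrows $x\to y$, $y\to z$, $z\to x$, $x'\to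 y$, $y'\to z$, $z'\to x$. - $8(2,1,1)$: the disjoint union of $4(2)$ and $4(1,1)$. -}

module Defs where

open import Data.List.Base using (List; []; _∷_)
open import Data.List.Membership.Propositional using (_∈_; _∉_)
open import Data.Nat.Base using (ℕ)
open import Data.Nat.GeneralisedArithmetic using (iterate)
open import Data.Product.Base using (Σ; ∃; _×_; _,_; proj₁)
open import Data.Rational.Base using (ℚ; _+_; _*_)
open import Data.Sum.Relation.Binary.Pointwise using (Pointwise; _⊎ₛ_; ⊎-respects₂)
open import Function.Base using (_on_)
open import Level using (0ℓ) renaming (suc to lsuc)
open import Relation.Binary.Bundles using (Setoid)
open import Relation.Binary.Core using (Rel)
open import Relation.Binary.Definitions using (_Respects₂_)
import Relation.Binary.Construct.On as On
open import Relation.Binary.Morphism.Structures using (IsOrderIsomorphism)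
open import Relation.Binary.PropositionalEquality.Core using (_≡_; refl; resp₂)
open import Relation.Binary.PropositionalEquality.Properties using (setoid)
open import Relation.Unary using (Pred)

Finite : {A : Set} → Pred A 0ℓ → Set
Finite P = ∃ λ xs → ∀ y → P y → y ∈ xs

-- The positive form of infinitude: outside every finite list there is a further
-- element satisfying P.  It implies ¬ Finite P, and is classically equivalent to it.
Infinite : {A : Set} → Pred A 0ℓ → Set
Infinite P = ∀ xs → ∃ λ y → y ∉ xs × P y

-- Vertices form a setoid so that a subset of ℚ can serve as vertex set with
-- equality that ignores the membership proofs.
record Digraph : Set (lsuc 0ℓ) where
  infix 4 _⟶_
  field
    vertices : Setoid 0ℓ 0ℓ
  open Setoid vertices public using (_≈_) renaming (Carrier to Vertex)
  field
    _⟶_      : Rel Vertex 0ℓ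
    respects : _⟶_ Respects₂ _≈_

-- Despite its name, IsOrderIsomorphism assumes no order axioms: it says that the
-- map is a bijection of setoids which preserves and reflects the given relation.
infix 4 _≅_
_≅_ : Digraph → Digraph → Set
G ≅ H = Σ (G.Vertex → H.Vertex) (IsOrderIsomorphism G._≈_ H._≈_ G._⟶_ H._⟶_)
  where
  module G = Digraph G
  module H = Digraph H

digraph : (V : Set) → Rel V 0ℓ → Digraph
digraph V _⟶_ = record
  { vertices = setoid V
  ; _⟶_      = _⟶_
  ; respects = resp₂ _⟶_
  }

infixr 5 _⊎ᴳ_
_⊎ᴳ_ : Digraph → Digraph → Digraph
G ⊎ᴳ H = record
  { vertices = G.vertices ⊎ₛ H.vertices
  ; _⟶_      = Pointwise G._⟶_ H._⟶_
  ; respects = ⊎-respects₂ G.respects H.respects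
  }
  where
  module G = Digraph G
  module H = Digraph H

f : ℚ → ℚ → ℚ
f c z = z * z + c

Orbit : ℚ → ℚ → Pred ℚ 0ℓ
Orbit c x y = ∃ λ n → iterate (f c) x n ≡ y

Preperiodic : ℚ → Pred ℚ 0ℓ
Preperiodic c x = Finite (Orbit c x)

PrePer : ℚ → Digraph
PrePer c = record
  { vertices = On.setoid (setoid ℚ) (proj₁ {B = Preperiodic c})
  ; _⟶_      = (λ x y → f c x ≡ y) on proj₁
  ; respects = (λ { refl e → e }) , (λ { refl e → e })
  }

data V4⟨1,1⟩ : Set where
  a a′ b b′ : V4⟨1,1⟩

data _⟶4⟨1,1⟩_ : Rel V4⟨1,1⟩ 0ℓ where
  a→a   : a  ⟶4⟨1,1⟩ a
  a′→a  : a′ ⟶4⟨1,1⟩ a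
  b→b   : b  ⟶4⟨1,1⟩ b
  b′→b  : b′ ⟶4⟨1,1⟩ b

G4⟨1,1⟩ : Digraph
G4⟨1,1⟩ = digraph V4⟨1,1⟩ _⟶4⟨1,1⟩_

data V4⟨2⟩ : Set where
  x y x′ y′ : V4⟨2⟩

data _⟶4⟨2⟩_ : Rel V4⟨2⟩ 0ℓ where
  x→y   : x  ⟶4⟨2⟩ y
  y→x   : y  ⟶4⟨2⟩ x
  x′→y  : x′ ⟶4⟨2⟩ y
  y′→x  : y′ ⟶4⟨2⟩ x

G4⟨2⟩ : Digraph
G4⟨2⟩ = digraph V4⟨2⟩ _⟶4⟨2⟩_

data V6⟨1,1⟩ : Set where
  a a′ b b′ u u′ : V6⟨1,1⟩

data _⟶6⟨1,1⟩_ : Rel V6⟨1,1⟩ 0ℓ where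
  a→a   : a  ⟶6⟨1,1⟩ a
  a′→a  : a′ ⟶6⟨1,1⟩ a
  b→b   : b  ⟶6⟨1,1⟩ b
  b′→b  : b′ ⟶6⟨1,1⟩ b
  u→a′  : u  ⟶6⟨1,1⟩ a′
  u′→a′ : u′ ⟶6⟨1,1⟩ a′

G6⟨1,1⟩ : Digraph
G6⟨1,1⟩ = digraph V6⟨1,1⟩ _⟶6⟨1,1⟩_

data V6⟨2⟩ : Set where
  x y x′ y′ u u′ : V6⟨2⟩

data _⟶6⟨2⟩_ : Rel V6⟨2⟩ 0ℓ where
  x→y   : x  ⟶6⟨2⟩ y
  y→x   : y  ⟶6⟨2⟩ x
  x′→y  : x′ ⟶6⟨2⟩ y
  y′→x  : y′ ⟶6⟨2⟩ x
  u→x′  : u  ⟶6⟨2⟩ x′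
  u′→x′ : u′ ⟶6⟨2⟩ x′

G6⟨2⟩ : Digraph
G6⟨2⟩ = digraph V6⟨2⟩ _⟶6⟨2⟩_

data V6⟨3⟩ : Set where
  x y z x′ y′ z′ : V6⟨3⟩

data _⟶6⟨3⟩_ : Rel V6⟨3⟩ 0ℓ where
  x→y   : x  ⟶6⟨3⟩ y
  y→z   : y  ⟶6⟨3⟩ z
  z→x   : z  ⟶6⟨3⟩ x
  x′→y  : x′ ⟶6⟨3⟩ y
  y′→z  : y′ ⟶6⟨3⟩ z
  z′→x  : z′ ⟶6⟨3⟩ x

G6⟨3⟩ : Digraph
G6⟨3⟩ = digraph V6⟨3⟩ _⟶6⟨3⟩_

G8⟨2,1,1⟩ : Digraph
G8⟨2,1,1⟩ = G4⟨2⟩ ⊎ᴳ G4⟨1,1⟩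

sixGraphs : List Digraph
sixGraphs = G4⟨1,1⟩ ∷ G4⟨2⟩ ∷ G6⟨1,1⟩ ∷ G6⟨2⟩ ∷ G6⟨3⟩ ∷ G8⟨2,1,1⟩ ∷ []

{-# OPTIONS --safe #-}
-- In the coordinate y = e x the map z ↦ z² − k/e² becomes y ↦ (y² − k)/e. Off the integers it
-- squares denominators, so preperiodic points have the form n/e, and only N = |n| matters:
-- it moves to M with N² = k ± e M. Take e = 2q and k = L² + 2qR. A preperiodic N has the parity
-- of L, and escape estimates confine it to a window N = L + 2i with 0 ≤ i ≤ h; the step then
-- reads 2i(L + i) = q(R ± M), so that q divides 2i(L + i). For the graphs with four vertices q = 1
-- and h = 1. For 6(1,1), 6(2) and 8(2,1,1), q = m is a power of 3 with m ∣ L + 1, whence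
-- m ∣ 2i(i − 1) and i ∈ {0, 1, m, m + 1}. For 6(3), q = m(m + 1). In each family k ≥ n e² for a
-- parameter n tending to infinity, so the numerators of c = −k/e² are unbounded.
module Submission where

open import Defs
open import Algebra.Bundles using (CommutativeMonoid)
open import Data.Empty using (⊥-elim)
open import Data.Fin.Base using (Fin)
open import Data.Fin.Patterns using (0F; 1F; 2F; 3F)
open import Data.Integer.Base as ℤ using (ℤ; +_; -[1+_]; ∣_∣; _◃_)
import Data.Integer.Divisibility.Signed as S
import Data.Integer.Properties as ℤ
import Data.Integer.Tactic.RingSolver as ℤ
open import Data.List.Base using (List; []; _∷_; map; allFin; cartesianProduct)
open import Data.List.Membership.Propositional using (_∈_)
open import Data.List.Membership.Propositional.Properties
  using (∈-map⁺; ∈-map⁻; ∈-allFin; ∈-cartesianProduct⁺)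
open import Data.List.Relation.Unary.All using (All; []; _∷_)
open import Data.List.Relation.Unary.Any using (here; there)
open import Data.Nat.Base as ℕ
  using (ℕ; zero; suc; _+_; _*_; _^_; _≤_; _<_; NonZero; s≤s; z≤n)
import Data.Nat.Coprimality as C
open C using (Coprime)
open import Data.Nat.Divisibility using (_∣_; _∣?_)
import Data.Nat.Divisibility as ℕ
open import Data.Nat.GeneralisedArithmetic using (iterate)
open import Data.Nat.Primality using (Prime; prime?; euclidsLemma; prime[2])
import Data.Nat.Properties as ℕ
import Data.Nat.Tactic.RingSolver as ℕ
open import Data.Product.Base using (Σ; ∃; _×_; _,_; proj₁; proj₂)
open import Data.Rational.Base as ℚ using (ℚ; mkℚ; 1ℚ; 1/_; toℚᵘ; ↥_; ↧_; ↧ₙ_)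
open import Data.Rational.Literals using (fromℤ)
import Data.Rational.Properties as ℚ
open import Data.Rational.Unnormalised.Base as ℚᵘ using (*≡*; _≃_)
import Data.Rational.Unnormalised.Properties as ℚᵘ
open import Data.Sign.Base as Sign using (Sign)
open import Data.Sum.Base using (_⊎_; inj₁; inj₂; [_,_]′)
open import Data.Sum.Relation.Binary.Pointwise using (inj₁; inj₂)
open import Relation.Binary.Bundles using (Setoid)
open import Relation.Binary.PropositionalEquality
open import Relation.Nullary using (¬_; yes; no)
open import Relation.Nullary.Decidable using (toWitness; toWitnessFalse)
open import Algebra.Properties.CommutativeSemigroup
  (CommutativeMonoid.commutativeSemigroup ℚ.*-1-commutativeMonoid) using (interchange)

-- Realizing the arrows is easy; the obstacle is to exclude every other rational preperiodic point.
-- Size alone settles `q = 1`. For larger `q` the window holds more than `q` indices and has to be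
-- thinned out by congruences: a prime power dividing `2i(i − 1)` divides one of the two coprime
-- factors entirely, provided that the prime is odd, so that the 2 is harmless. The constants come
-- from the graphs. Two fixed points have sum 1 and the points of a 2-cycle have sum -1; in these
-- families they have opposite signs, so their absolute numerators differ by `e = 2q` and their
-- indices by `q`. Index 0 steps to `−R`, so `R` is the absolute numerator of its image; in the
-- families with `q = m` the arrow from index 1 then determines `L`. The graph 6(3) uses the
-- classical parametrization of rational 3-cycles, with numerators m³ - m - 1, -(m³ + 2m² + 3m + 1)
-- and m³ + 2m² + m + 1 over 2m(m + 1).

-- Finite orbits and the escape principle.

module _ where
  open ℕ.≤-Reasoning

  bounded : {A : Set} (μ : A → ℕ) (xs : List A) → ∃ λ B → ∀ {w} → w ∈ xs → μ w ≤ B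
  bounded μ []       = 0 , λ ()
  bounded μ (v ∷ xs) with bounded μ xs
  ... | B , le = μ v ℕ.⊔ B , λ
    { (here refl) → ℕ.m≤m⊔n (μ v) B
    ; (there w∈)  → ℕ.≤-trans (le w∈) (ℕ.m≤n⊔m (μ v) B) }

  -- `n` steps inside `P` raise `μ` by at least `n`, while the finite list containing the orbit
  -- bounds `μ`. It serves twice: with denominators as `μ`, and with absolute numerators.
  escape : ∀ {c} (P : ℚ → Set) (μ : ℚ → ℕ) →
           (∀ {z} → P z → P (f c z) × μ z < μ (f c z)) →
           ∀ {z} → Preperiodic c z → ¬ P z
  escape {c} P μ grow {w} (xs , orbit∈) Pw with bounded μ xs
  ... | B , le = ℕ.<-irrefl refl (begin-strict
    B                            <⟨ ℕ.n<1+n B ⟩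
    suc B                        ≤⟨ lower (suc B) Pw ⟩
    μ (iterate (f c) w (suc B))  ≤⟨ le (orbit∈ _ (suc B , refl)) ⟩
    B                            ∎)
    where
    grown : ∀ n {z} → P z → n + μ z ≤ μ (iterate (f c) z n)
    grown zero    Pz = ℕ.≤-refl
    grown (suc n) {w} Pw = begin
      suc n + μ w                ≡⟨ ℕ.+-suc n (μ w) ⟨
      n + suc (μ w)              ≤⟨ ℕ.+-monoʳ-≤ n (proj₂ (grow Pw)) ⟩
      n + μ (f c w)              ≤⟨ grown n (proj₁ (grow Pw)) ⟩
      μ (iterate (f c) w (suc n))  ∎

    lower : ∀ n {z} → P z → n ≤ μ (iterate (f c) z n)
    lower n Pz = ℕ.≤-trans (ℕ.m≤m+n n _) (grown n Pz)

preperiodic-f : ∀ {c z} → Preperiodic c z → Preperiodic c (f c z)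
preperiodic-f (xs , orbit∈) = xs , λ { w (n , eq) → orbit∈ w (suc n , eq) }

closed⇒preperiodic : ∀ {c} xs → (∀ {z} → z ∈ xs → f c z ∈ xs) →
                     ∀ {z} → z ∈ xs → Preperiodic c z
closed⇒preperiodic {c} xs closed z∈ = xs , λ { w (n , refl) → go n z∈ }
  where
  go : ∀ n {z} → z ∈ xs → iterate (f c) z n ∈ xs
  go zero    z∈ = z∈
  go (suc n) z∈ = go n (closed z∈)

-- Denominators of preperiodic points and the coordinate `e x`.

coprime-* : ∀ {m n o} → Coprime m n → Coprime m o → Coprime m (n * o)
coprime-* mn mo (d∣m , d∣no) =
  mo (d∣m , C.coprime-divisor (λ (i∣d , i∣n) → mn (ℕ.∣-trans i∣d d∣m , i∣n)) d∣no)

ι : ℤ → ℚ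
ι = fromℤ

ι-injective : ∀ {m n} → ι m ≡ ι n → m ≡ n
ι-injective refl = refl

ι-* : ∀ m n → ι m ℚ.* ι n ≡ ι (m ℤ.* n)
ι-* m n = ℚ.toℚᵘ-injective (ℚᵘ.≃-trans (ℚ.toℚᵘ-homo-* (ι m) (ι n)) (*≡* refl))

ι-+ : ∀ m n → ι m ℚ.+ ι n ≡ ι (m ℤ.+ n)
ι-+ m n = ℚ.toℚᵘ-injective (ℚᵘ.≃-trans (ℚ.toℚᵘ-homo-+ (ι m) (ι n)) (*≡* (lemma m n)))
  where
  lemma : ∀ m n → (m ℤ.* + 1 ℤ.+ n ℤ.* + 1) ℤ.* + 1 ≡ (m ℤ.+ n) ℤ.* + 1
  lemma = ℤ.solve-∀

-- The denominator of p² + j is the square of that of p.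
denominator-square : ∀ p p′ e j → ι e ℚ.* p′ ≡ p ℚ.* p ℚ.+ ι j → ↧ₙ p * ↧ₙ p ∣ ↧ₙ p′
denominator-square p@(mkℚ Y d cop) p′@(mkℚ Y′ d′ _) e j eq =
  C.coprime-divisor
    (λ (i∣DD , i∣X) → C.sym (coprime-* (X⊥D) (X⊥D)) (i∣DD , i∣X))
    (ℕ.divides ∣ e ℤ.* Y′ ∣ divides-eq)
  where
  D  = + suc d
  D′ = + suc d′
  -- `X / D²` is `p² + j`. Since `X` is coprime to `D`, cross-multiplication forces `D²` into the
  -- denominator of `p′`.
  X  = Y ℤ.* Y ℤ.+ j ℤ.* (D ℤ.* D)

  lhs : toℚᵘ (ι e ℚ.* p′) ≃ toℚᵘ (ι e) ℚᵘ.* toℚᵘ p′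
  lhs = ℚ.toℚᵘ-homo-* (ι e) p′

  rhs : toℚᵘ (p ℚ.* p ℚ.+ ι j) ≃ toℚᵘ p ℚᵘ.* toℚᵘ p ℚᵘ.+ toℚᵘ (ι j)
  rhs = ℚᵘ.≃-trans (ℚ.toℚᵘ-homo-+ (p ℚ.* p) (ι j))
                   (ℚᵘ.+-congˡ (toℚᵘ (ι j)) (ℚ.toℚᵘ-homo-* p p))

  cross : (e ℤ.* Y′) ℤ.* (D ℤ.* D ℤ.* + 1)
          ≡ (Y ℤ.* Y ℤ.* + 1 ℤ.+ j ℤ.* (D ℤ.* D)) ℤ.* (+ 1 ℤ.* D′)
  cross with ℚᵘ.≃-trans (ℚᵘ.≃-sym lhs) (ℚᵘ.≃-trans (ℚ.toℚᵘ-cong eq) rhs)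
  ... | *≡* eq′ = eq′

  tidy : ∀ Y j D D′ → (Y ℤ.* Y ℤ.* + 1 ℤ.+ j ℤ.* (D ℤ.* D)) ℤ.* (+ 1 ℤ.* D′)
         ≡ (Y ℤ.* Y ℤ.+ j ℤ.* (D ℤ.* D)) ℤ.* D′
  tidy = ℤ.solve-∀

  divides-eq : ∣ X ∣ * suc d′ ≡ ∣ e ℤ.* Y′ ∣ * (suc d * suc d)
  divides-eq = begin
    ∣ X ∣ * suc d′                       ≡⟨ ℤ.abs-* X D′ ⟨
    ∣ X ℤ.* D′ ∣                           ≡⟨ cong ∣_∣ (trans cross (tidy Y j D D′)) ⟨
    ∣ (e ℤ.* Y′) ℤ.* (D ℤ.* D ℤ.* + 1) ∣   ≡⟨ cong (λ t → ∣ (e ℤ.* Y′) ℤ.* t ∣) (ℤ.*-identityʳ (D ℤ.* D)) ⟩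
    ∣ (e ℤ.* Y′) ℤ.* (D ℤ.* D) ∣           ≡⟨ ℤ.abs-* (e ℤ.* Y′) (D ℤ.* D) ⟩
    ∣ e ℤ.* Y′ ∣ * ∣ D ℤ.* D ∣           ≡⟨ cong (∣ e ℤ.* Y′ ∣ *_) (ℤ.abs-* D D) ⟩
    ∣ e ℤ.* Y′ ∣ * (suc d * suc d)     ∎
    where open ≡-Reasoning

  Y⊥D : Coprime ∣ Y ∣ (suc d)
  Y⊥D = C.recompute cop

  X⊥D : Coprime ∣ X ∣ (suc d)
  X⊥D {i} (i∣X , i∣D) = YY⊥D (i∣YY , i∣D)
    where
    YY⊥D : Coprime (∣ Y ∣ * ∣ Y ∣) (suc d)
    YY⊥D = C.sym (coprime-* (C.sym Y⊥D) (C.sym Y⊥D))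

    i∣jDD : + i S.∣ j ℤ.* (D ℤ.* D)
    i∣jDD = S.∣n⇒∣m*n j (S.∣m⇒∣m*n {m = D} D (S.∣ᵤ⇒∣ i∣D))

    i∣YY : i ∣ ∣ Y ∣ * ∣ Y ∣
    i∣YY = subst (i ∣_) (ℤ.abs-* Y Y)
             (S.∣⇒∣ᵤ (S.∣m+n∣n⇒∣m {m = Y ℤ.* Y} {n = j ℤ.* (D ℤ.* D)} (S.∣ᵤ⇒∣ i∣X) i∣jDD))

opaque
  c⟨_,_⟩ : (k e : ℕ) .{{_ : NonZero e}} → ℚ
  c⟨ k , e ⟩ = ι (ℤ.- + k) ℚ.* (1/ ι (+ e) ℚ.* 1/ ι (+ e))

  pt : (e : ℕ) .{{_ : NonZero e}} → ℤ → ℚ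
  pt e n = 1/ ι (+ e) ℚ.* ι n

module _ (k e : ℕ) .{{e≢0 : NonZero e}} where
  E : ℚ
  E = ι (+ e)

  opaque
    unfolding pt
    E*pt : ∀ n → E ℚ.* pt e n ≡ ι n
    E*pt n = begin
      E ℚ.* (1/ E ℚ.* ι n)  ≡⟨ ℚ.*-assoc E (1/ E) (ι n) ⟨
      E ℚ.* 1/ E ℚ.* ι n    ≡⟨ cong (ℚ._* ι n) (ℚ.*-inverseʳ E) ⟩
      1ℚ ℚ.* ι n            ≡⟨ ℚ.*-identityˡ (ι n) ⟩
      ι n                 ∎
      where
      open ≡-Reasoning

    E*-injective : ∀ {v w} → E ℚ.* v ≡ E ℚ.* w → v ≡ w
    E*-injective {v} {w} eq = begin
      v                   ≡⟨ ℚ.*-identityˡ v ⟨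
      1ℚ ℚ.* v              ≡⟨ cong (ℚ._* v) (ℚ.*-inverseˡ E) ⟨
      1/ E ℚ.* E ℚ.* v      ≡⟨ ℚ.*-assoc (1/ E) E v ⟩
      1/ E ℚ.* (E ℚ.* v)    ≡⟨ cong (1/ E ℚ.*_) eq ⟩
      1/ E ℚ.* (E ℚ.* w)    ≡⟨ ℚ.*-assoc (1/ E) E w ⟨
      1/ E ℚ.* E ℚ.* w      ≡⟨ cong (ℚ._* w) (ℚ.*-inverseˡ E) ⟩
      1ℚ ℚ.* w              ≡⟨ ℚ.*-identityˡ w ⟩
      w                   ∎
      where
      open ≡-Reasoning

  opaque
    unfolding c⟨_,_⟩
    EE*c : E ℚ.* E ℚ.* c⟨ k , e ⟩ ≡ ι (ℤ.- + k)
    EE*c = begin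
      E ℚ.* E ℚ.* (κ ℚ.* (1/ E ℚ.* 1/ E))    ≡⟨ cong (E ℚ.* E ℚ.*_) (ℚ.*-comm κ (1/ E ℚ.* 1/ E)) ⟩
      E ℚ.* E ℚ.* (1/ E ℚ.* 1/ E ℚ.* κ)      ≡⟨ ℚ.*-assoc (E ℚ.* E) (1/ E ℚ.* 1/ E) κ ⟨
      E ℚ.* E ℚ.* (1/ E ℚ.* 1/ E) ℚ.* κ      ≡⟨ cong (ℚ._* κ) (interchange E E (1/ E) (1/ E)) ⟩
      (E ℚ.* 1/ E) ℚ.* (E ℚ.* 1/ E) ℚ.* κ    ≡⟨ cong (λ t → t ℚ.* t ℚ.* κ) (ℚ.*-inverseʳ E) ⟩
      1ℚ ℚ.* 1ℚ ℚ.* κ                        ≡⟨ cong (ℚ._* κ) (ℚ.*-identityˡ 1ℚ) ⟩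
      1ℚ ℚ.* κ                             ≡⟨ ℚ.*-identityˡ κ ⟩
      κ                                  ∎
      where
      open ≡-Reasoning
      κ : ℚ
      κ = ι (ℤ.- + k)

  c : ℚ
  c = c⟨ k , e ⟩

  E*f : ∀ w → E ℚ.* (E ℚ.* f c w) ≡ (E ℚ.* w) ℚ.* (E ℚ.* w) ℚ.+ ι (ℤ.- + k)
  E*f w = begin
    E ℚ.* (E ℚ.* (w ℚ.* w ℚ.+ c))              ≡⟨ ℚ.*-assoc E E (w ℚ.* w ℚ.+ c) ⟨
    E ℚ.* E ℚ.* (w ℚ.* w ℚ.+ c)                ≡⟨ ℚ.*-distribˡ-+ (E ℚ.* E) (w ℚ.* w) c ⟩
    E ℚ.* E ℚ.* (w ℚ.* w) ℚ.+ E ℚ.* E ℚ.* c        ≡⟨ cong₂ ℚ._+_ (interchange E E w w) EE*c ⟩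
    (E ℚ.* w) ℚ.* (E ℚ.* w) ℚ.+ ι (ℤ.- + k)    ∎
    where open ≡-Reasoning

  pt-injective : ∀ {m n} → pt e m ≡ pt e n → m ≡ n
  pt-injective {m} {n} eq = ι-injective (trans (sym (E*pt m)) (trans (cong (E ℚ.*_) eq) (E*pt n)))

  private
    f-pt′ : ∀ n → E ℚ.* (E ℚ.* f c (pt e n)) ≡ ι (n ℤ.* n ℤ.+ ℤ.- + k)
    f-pt′ n = begin
      E ℚ.* (E ℚ.* f c (pt e n))                       ≡⟨ E*f (pt e n) ⟩
      (E ℚ.* pt e n) ℚ.* (E ℚ.* pt e n) ℚ.+ ι (ℤ.- + k)    ≡⟨ cong (λ t → t ℚ.* t ℚ.+ ι (ℤ.- + k)) (E*pt n) ⟩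
      ι n ℚ.* ι n ℚ.+ ι (ℤ.- + k)                      ≡⟨ cong (ℚ._+ ι (ℤ.- + k)) (ι-* n n) ⟩
      ι (n ℤ.* n) ℚ.+ ι (ℤ.- + k)                    ≡⟨ ι-+ (n ℤ.* n) (ℤ.- + k) ⟩
      ι (n ℤ.* n ℤ.+ ℤ.- + k)                      ∎
      where open ≡-Reasoning

    E*E*pt : ∀ m → E ℚ.* (E ℚ.* pt e m) ≡ ι (+ e ℤ.* m)
    E*E*pt m = trans (cong (E ℚ.*_) (E*pt m)) (ι-* (+ e) m)

  f-pt⁺ : ∀ {n m} → n ℤ.* n ≡ + k ℤ.+ + e ℤ.* m → f c (pt e n) ≡ pt e m
  f-pt⁺ {n} {m} eq = E*-injective (E*-injective (begin
    E ℚ.* (E ℚ.* f c (pt e n))                   ≡⟨ f-pt′ n ⟩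
    ι (n ℤ.* n ℤ.+ ℤ.- + k)                  ≡⟨ cong (λ t → ι (t ℤ.+ ℤ.- + k)) eq ⟩
    ι (+ k ℤ.+ + e ℤ.* m ℤ.+ ℤ.- + k)        ≡⟨ cong ι (cancel (+ k) (+ e ℤ.* m)) ⟩
    ι (+ e ℤ.* m)                            ≡⟨ E*E*pt m ⟨
    E ℚ.* (E ℚ.* pt e m)                         ∎))
    where
    open ≡-Reasoning
    cancel : ∀ i j → i ℤ.+ j ℤ.+ ℤ.- i ≡ j
    cancel = ℤ.solve-∀

  f-pt⁻ : ∀ {n m} → f c (pt e n) ≡ pt e m → n ℤ.* n ≡ + k ℤ.+ + e ℤ.* m
  f-pt⁻ {n} {m} eq = begin
    n ℤ.* n                            ≡⟨ cancel (n ℤ.* n) (+ k) ⟩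
    + k ℤ.+ (n ℤ.* n ℤ.+ ℤ.- + k)      ≡⟨ cong (λ t → + k ℤ.+ t) (ι-injective
      (trans (sym (f-pt′ n)) (trans (cong (λ t → E ℚ.* (E ℚ.* t)) eq) (E*E*pt m)))) ⟩
    + k ℤ.+ + e ℤ.* m                  ∎
    where
    open ≡-Reasoning
    cancel : ∀ i j → i ≡ j ℤ.+ (i ℤ.+ ℤ.- j)
    cancel = ℤ.solve-∀

  denominator : ℚ → ℕ
  denominator w = ↧ₙ (E ℚ.* w)

  denominator-∣ : ∀ w → denominator w * denominator w ∣ denominator (f c w)
  denominator-∣ w = denominator-square (E ℚ.* w) (E ℚ.* f c w) (+ e) (ℤ.- + k) (E*f w)

  denominator-grows : ∀ {w} → 1 < denominator w →
                      1 < denominator (f c w) × denominator w < denominator (f c w)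
  denominator-grows {w} 1<d = ℕ.<-trans 1<d d<d′ , d<d′
    where
    d′ = denominator (f c w)
    d<d′ : denominator w < d′
    d<d′ = ℕ.<-≤-trans
      (ℕ.m<m*n (denominator w) (denominator w) {{ℕ.>-nonZero (ℕ.<-trans ℕ.z<s 1<d)}} 1<d)
      (ℕ.∣⇒≤ (denominator-∣ w))

  integral : ∀ {w} → ↧ₙ w ≡ 1 → ∃ λ n → w ≡ ι n
  integral {mkℚ n 0 _} refl = n , refl

  -- `escape` with the denominator of `E * w` as measure: once above 1 it is at least squared at
  -- each step, so it must be 1.
  preperiodic⇒pt : ∀ {w} → Preperiodic c w → ∃ λ n → w ≡ pt e n
  preperiodic⇒pt {w} pre with integral {E ℚ.* w} (ℕ.≤-antisym
      (ℕ.≮⇒≥ (escape (λ v → 1 < denominator v) denominator (λ {v} → denominator-grows {v}) pre))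
      ℕ.z<s)
  ... | n , eq = n , E*-injective (trans eq (sym (E*pt n)))

  numerator-c : e * e * ∣ ↥ c ∣ ≡ k * ↧ₙ c
  numerator-c = go (↥ c) (↧ₙ c) cross
    where
    cross : (+ e ℤ.* + e ℤ.* ↥ c) ℤ.* + 1 ≡ (ℤ.- + k) ℤ.* (+ 1 ℤ.* ↧ c)
    cross with c | EE*c
    ... | mkℚ p d _ | eq with ℚᵘ.≃-trans (ℚᵘ.≃-sym (ℚᵘ.≃-trans
             (ℚ.toℚᵘ-homo-* (E ℚ.* E) (mkℚ p d _))
             (ℚᵘ.*-congʳ (ℚ.toℚᵘ-homo-* E E)))) (ℚ.toℚᵘ-cong eq)
    ...   | *≡* eq′ = eq′
    go : ∀ p d → (+ e ℤ.* + e ℤ.* p) ℤ.* + 1 ≡ (ℤ.- + k) ℤ.* (+ 1 ℤ.* + d) →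
         e * e * ∣ p ∣ ≡ k * d
    go p d eq = begin
      e * e * ∣ p ∣                     ≡⟨ cong (_* ∣ p ∣) (ℤ.abs-* (+ e) (+ e)) ⟨
      ∣ + e ℤ.* + e ∣ * ∣ p ∣             ≡⟨ ℤ.abs-* (+ e ℤ.* + e) p ⟨
      ∣ + e ℤ.* + e ℤ.* p ∣                 ≡⟨ cong ∣_∣ (ℤ.*-identityʳ (+ e ℤ.* + e ℤ.* p)) ⟨
      ∣ (+ e ℤ.* + e ℤ.* p) ℤ.* + 1 ∣       ≡⟨ cong ∣_∣ eq ⟩
      ∣ (ℤ.- + k) ℤ.* (+ 1 ℤ.* + d) ∣       ≡⟨ cong (λ t → ∣ (ℤ.- + k) ℤ.* t ∣) (ℤ.*-identityˡ (+ d)) ⟩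
      ∣ (ℤ.- + k) ℤ.* + d ∣                 ≡⟨ ℤ.abs-* (ℤ.- + k) (+ d) ⟩
      ∣ ℤ.- + k ∣ * d                     ≡⟨ cong (_* d) (ℤ.∣-i∣≡∣i∣ (+ k)) ⟩
      k * d                               ∎
      where open ≡-Reasoning

  numerator-large : ∀ t → t * (e * e) ≤ k → t ≤ ∣ ↥ c ∣
  numerator-large t te²≤k = ℕ.*-cancelˡ-≤ (e * e) {{ℕ.m*n≢0 e e}} (begin
    e * e * t          ≡⟨ ℕ.*-comm (e * e) t ⟩
    t * (e * e)        ≤⟨ te²≤k ⟩
    k                      ≤⟨ ℕ.m≤m*n k (↧ₙ c) ⟩
    k * ↧ₙ c             ≡⟨ numerator-c ⟨
    e * e * ∣ ↥ c ∣    ∎)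
    where open ℕ.≤-Reasoning

-- If `B` bounds the numerators in `xs`, the member for `B + 1` has `k ≥ (B + 1) e²`, hence a
-- numerator of absolute value above `B`.
infinite : {P : ℚ → Set} →
           (∀ t → Σ ℕ λ k → Σ ℕ λ e → Σ (NonZero e) λ nz →
              t * (e * e) ≤ k × P (c⟨_,_⟩ k e {{nz}})) →
           Infinite P
infinite family xs with bounded (λ q → ∣ ↥ q ∣) xs
... | B , le with family (suc B)
... | k , e , nz , large , Pc = c⟨_,_⟩ k e {{nz}} , (λ c∈xs → ℕ.<-irrefl refl
        (ℕ.≤-trans (numerator-large k e {{nz}} (suc B) large) (le c∈xs))) , Pc

-- The map on absolute numerators.

-- A negative image is moved to the other side, so that no subtraction occurs in ℕ.
Step : (k e N : ℕ) → Sign → ℕ → Set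
Step k e N Sign.+ M = N * N ≡ k + e * M
Step k e N Sign.- M = N * N + e * M ≡ k

-- These two properties are all that the classification uses of the absolute numerators of
-- preperiodic points. Keeping `B` abstract turns the rest into arithmetic in ℕ.
record Trapped (k e : ℕ) (B : ℕ → Set) : Set₁ where
  field
    step    : ∀ {N} → B N → ∃ λ s → ∃ λ M → B M × Step k e N s M
    escapes : (P : ℕ → Set) → (∀ {N s M} → P N → Step k e N s M → P M × N < M) →
              ∀ {N} → B N → ¬ P N

n*n≡∣n∣*∣n∣ : ∀ n → n ℤ.* n ≡ + (∣ n ∣ * ∣ n ∣)
n*n≡∣n∣*∣n∣ (+ n)      = sym (ℤ.pos-* n n)
n*n≡∣n∣*∣n∣ (-[1+ n ]) = refl

fromStep : ∀ {k e} n s {M} → Step k e ∣ n ∣ s M → n ℤ.* n ≡ + k ℤ.+ + e ℤ.* (s ◃ M)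
fromStep {k} {e} n Sign.+ {M} eq = begin
  n ℤ.* n                        ≡⟨ n*n≡∣n∣*∣n∣ n ⟩
  + (∣ n ∣ * ∣ n ∣)            ≡⟨ cong (λ t → + t) eq ⟩
  + (k + e * M)              ≡⟨ ℤ.pos-+ k (e * M) ⟩
  + k ℤ.+ + (e * M)            ≡⟨ cong (λ t → + k ℤ.+ t) (ℤ.pos-* e M) ⟩
  + k ℤ.+ + e ℤ.* + M            ≡⟨ cong (λ t → + k ℤ.+ + e ℤ.* t) (ℤ.+◃n≡+n M) ⟨
  + k ℤ.+ + e ℤ.* (Sign.+ ◃ M)   ∎
  where open ≡-Reasoning
fromStep {k} {e} n Sign.- {M} refl = begin
  n ℤ.* n                                      ≡⟨ n*n≡∣n∣*∣n∣ n ⟩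
  + N²                                         ≡⟨ cancel (+ N²) (+ e) (+ M) ⟩
  + N² ℤ.+ + e ℤ.* + M ℤ.+ + e ℤ.* (ℤ.- + M)   ≡⟨ cong₂ (λ t u → t ℤ.+ + e ℤ.* u)
    (trans (cong (λ t → + N² ℤ.+ t) (sym (ℤ.pos-* e M))) (sym (ℤ.pos-+ N² (e * M))))
    (sym (ℤ.-◃n≡-n M)) ⟩
  + (N² + e * M) ℤ.+ + e ℤ.* (Sign.- ◃ M)  ∎
  where
  open ≡-Reasoning
  N² = ∣ n ∣ * ∣ n ∣
  cancel : ∀ i j l → i ≡ i ℤ.+ j ℤ.* l ℤ.+ j ℤ.* (ℤ.- l)
  cancel = ℤ.solve-∀

toStep : ∀ {k e} n s {M} → n ℤ.* n ≡ + k ℤ.+ + e ℤ.* (s ◃ M) → Step k e ∣ n ∣ s M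
toStep {k} {e} n Sign.+ {M} eq = ℤ.+-injective (begin
  + (∣ n ∣ * ∣ n ∣)            ≡⟨ n*n≡∣n∣*∣n∣ n ⟨
  n ℤ.* n                        ≡⟨ eq ⟩
  + k ℤ.+ + e ℤ.* (Sign.+ ◃ M)   ≡⟨ cong (λ t → + k ℤ.+ + e ℤ.* t) (ℤ.+◃n≡+n M) ⟩
  + k ℤ.+ + e ℤ.* + M            ≡⟨ cong (λ t → + k ℤ.+ t) (ℤ.pos-* e M) ⟨
  + k ℤ.+ + (e * M)            ≡⟨ ℤ.pos-+ k (e * M) ⟨
  + (k + e * M)              ∎)
  where open ≡-Reasoning
toStep {k} {e} n Sign.- {M} eq = ℤ.+-injective (begin
  + (N² + e * M)                           ≡⟨ ℤ.pos-+ N² (e * M) ⟩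
  + N² ℤ.+ + (e * M)                         ≡⟨ cong₂ ℤ._+_ (trans (sym (n*n≡∣n∣*∣n∣ n)) eq) (ℤ.pos-* e M) ⟩
  + k ℤ.+ + e ℤ.* (Sign.- ◃ M) ℤ.+ + e ℤ.* + M  ≡⟨ cong (λ t → + k ℤ.+ + e ℤ.* t ℤ.+ + e ℤ.* + M) (ℤ.-◃n≡-n M) ⟩
  + k ℤ.+ + e ℤ.* (ℤ.- + M) ℤ.+ + e ℤ.* + M    ≡⟨ cancel (+ k) (+ e) (+ M) ⟩
  + k                                          ∎)
  where
  open ≡-Reasoning
  N² = ∣ n ∣ * ∣ n ∣
  cancel : ∀ i j l → i ℤ.+ j ℤ.* (ℤ.- l) ℤ.+ j ℤ.* l ≡ i
  cancel = ℤ.solve-∀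

module _ (k e : ℕ) .{{_ : NonZero e}} where
  -- f and Preperiodic at c, made opaque because the conversion checker would
  -- otherwise unfold the arithmetic of ℚ.
  opaque
    F : ℚ → ℚ
    F = f (c k e)

    PP : ℚ → Set
    PP = Preperiodic (c k e)

    size : ℚ → ℕ
    size w = ∣ ↥ (E k e ℚ.* w) ∣

    f≡F : ∀ w → f (c k e) w ≡ F w
    f≡F w = refl

    toPP : ∀ {w} → Preperiodic (c k e) w → PP w
    toPP pre = pre

    fromPP : ∀ {w} → PP w → Preperiodic (c k e) w
    fromPP pre = pre

    PP-F : ∀ {w} → PP w → PP (F w)
    PP-F {w} = preperiodic-f {c k e} {w}

    PP-closed : ∀ xs → (∀ {w} → w ∈ xs → F w ∈ xs) → ∀ {w} → w ∈ xs → PP w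
    PP-closed xs closed = closed⇒preperiodic {c k e} xs closed

    PP-escape : (P : ℚ → Set) → (∀ {w} → P w → P (F w) × size w < size (F w)) →
                ∀ {w} → PP w → ¬ P w
    PP-escape P grow {w} = escape {c k e} P size grow {w}

    PP⇒pt : ∀ {w} → PP w → ∃ λ n → w ≡ pt e n
    PP⇒pt {w} = preperiodic⇒pt k e {w}

    F-pt : ∀ n s M → Step k e (∣ n ∣) s M → F (pt e n) ≡ pt e (s ◃ M)
    F-pt n s M st = f-pt⁺ k e {n} {s ◃ M} (fromStep n s st)

    pt-F : ∀ n m → F (pt e n) ≡ pt e m → Step k e (∣ n ∣) (ℤ.sign m) (∣ m ∣)
    pt-F n m eq = toStep n (ℤ.sign m) (trans (f-pt⁻ k e {n} {m} eq)
      (cong (λ t → + k ℤ.+ + e ℤ.* t) (sym (ℤ.signᵢ◃∣i∣≡i m))))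

    size-pt : ∀ n → size (pt e n) ≡ ∣ n ∣
    size-pt n = cong (λ t → ∣ ↥ t ∣) (E*pt k e n)

  AbsPrePer : ℕ → Set
  AbsPrePer N = ∃ λ n → ∣ n ∣ ≡ N × PP (pt e n)

  step-pt : ∀ {n} → PP (pt e n) → ∃ λ m →
            PP (pt e m) × F (pt e n) ≡ pt e m × Step k e (∣ n ∣) (ℤ.sign m) (∣ m ∣)
  step-pt {n} pre with PP⇒pt (PP-F pre)
  ... | m , eq = m , subst PP eq (PP-F pre) , eq , pt-F n m eq

  trapped : Trapped k e AbsPrePer
  trapped = record
    { step    = λ { (n , refl , pre) → let m , pre′ , _ , st = step-pt pre in
                    ℤ.sign m , ∣ m ∣ , (m , refl , pre′) , st }
    ; escapes = λ { P grow (n , refl , pre) Pn → PP-escape (Q P) (grow′ P grow) pre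
                    (n , refl , Pn , pre) }
    }
    where
    -- `PP w` is carried along because it is preperiodicity that makes the image again some
    -- `pt e m`.
    Q : (ℕ → Set) → ℚ → Set
    Q P w = ∃ λ n → w ≡ pt e n × P ∣ n ∣ × PP w

    grow′ : ∀ P → (∀ {N s M} → P N → Step k e N s M → P M × N < M) →
            ∀ {w} → Q P w → Q P (F w) × size w < size (F w)
    grow′ P grow (n , refl , Pn , pre) with step-pt pre
    ... | m , pre′ , eq , st with grow Pn st
    ... | Pm , n<m = (m , eq , Pm , PP-F pre) ,
      subst₂ _<_ (sym (size-pt n)) (sym (trans (cong size eq) (size-pt m))) n<m

-- Symmetric graphs and the isomorphism criterion.

-- A graph symmetric under z ↦ −z: its vertices are ±0, …, ±(r−1), and the arrow
-- from ±i does not depend on the sign.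
record Symmetric (G : Digraph) (r : ℕ) : Set where
  open Digraph G
  field
    next        : Fin r → Sign × Fin r
    code        : Vertex → Sign × Fin r
    decode      : Sign × Fin r → Vertex
    code-cong   : ∀ {v w} → v ≈ w → code v ≡ code w
    code-decode : ∀ p → code (decode p) ≡ p
    decode-code : ∀ v → decode (code v) ≈ v
    arrow       : ∀ v → v ⟶ decode (next (proj₂ (code v)))
    arrow-code  : ∀ {v w} → v ⟶ w → code w ≡ next (proj₂ (code v))

module _ {G r} (sym-G : Symmetric G r) (k e : ℕ) .{{_ : NonZero e}} (N : Fin r → ℕ)
  {{N≢0 : ∀ {i} → NonZero (N i)}}
  (N-injective : ∀ {i j} → N i ≡ N j → i ≡ j)
  (steps : ∀ i → Step k e (N i) (proj₁ (Symmetric.next sym-G i)) (N (proj₂ (Symmetric.next sym-G i))))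
  (complete : ∀ {B} → Trapped k e B → ∀ {n} → B n → ∃ λ i → n ≡ N i)
  where
  open Symmetric sym-G
  open Digraph G
  private
    module V = Setoid vertices
    module P = Digraph (PrePer (c k e))

  signed : Sign × Fin r → ℤ
  signed (s , i) = s ◃ N i

  point : Sign × Fin r → ℚ
  point p = pt e (signed p)

  -- The sign can be recovered from `s ◃ N i` because `N i` is nonzero.
  signed-injective : ∀ {p q} → signed p ≡ signed q → p ≡ q
  signed-injective {s , i} {t , j} eq = cong₂ _,_ s≡t i≡j
    where
    s≡t = trans (sym (ℤ.sign-◃ s (N i))) (trans (cong ℤ.sign eq) (ℤ.sign-◃ t (N j)))
    i≡j = N-injective (trans (sym (ℤ.abs-◃ s (N i))) (trans (cong ∣_∣ eq) (ℤ.abs-◃ t (N j))))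

  point-injective : ∀ {p q} → point p ≡ point q → p ≡ q
  point-injective eq = signed-injective (pt-injective k e eq)

  f-point : ∀ p → F k e (point p) ≡ point (next (proj₂ p))
  f-point p@(s , i) = F-pt k e (signed p) (proj₁ (next i)) _
    (subst (λ t → Step k e t (proj₁ (next i)) (N (proj₂ (next i)))) (sym (ℤ.abs-◃ s (N i))) (steps i))

  codes : List (Sign × Fin r)
  codes = cartesianProduct (Sign.+ ∷ Sign.- ∷ []) (allFin r)

  ∈-codes : ∀ p → p ∈ codes
  ∈-codes (Sign.+ , i) = ∈-cartesianProduct⁺ {xs = Sign.+ ∷ Sign.- ∷ []} (here refl) (∈-allFin i)
  ∈-codes (Sign.- , i) = ∈-cartesianProduct⁺ {xs = Sign.+ ∷ Sign.- ∷ []} (there (here refl)) (∈-allFin i)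

  point-preperiodic : ∀ p → PP k e (point p)
  point-preperiodic p = PP-closed k e (map point codes) closed (∈-map⁺ point (∈-codes p))
    where
    closed : ∀ {w} → w ∈ map point codes → F k e w ∈ map point codes
    closed w∈ with ∈-map⁻ point w∈
    ... | q , _ , refl = subst (_∈ map point codes) (sym (f-point q)) (∈-map⁺ point (∈-codes _))

  classify : ∀ {w} → PP k e w → ∃ λ p → w ≡ point p
  classify pre with PP⇒pt k e pre
  ... | n , refl with complete (trapped k e) (n , refl , pre)
  ... | i , eq = (ℤ.sign n , i) ,
    cong (pt e) (trans (sym (ℤ.signᵢ◃∣i∣≡i n)) (cong (ℤ.sign n ◃_) eq))

  opaque
    toCode : P.Vertex → Sign × Fin r
    toCode (w , pre) = proj₁ (classify (toPP k e {w} pre))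

    point-toCode : ∀ v → proj₁ v ≡ point (toCode v)
    point-toCode (w , pre) = proj₂ (classify (toPP k e {w} pre))

  toCode-cong : ∀ {v w} → v P.≈ w → toCode v ≡ toCode w
  toCode-cong {v} {w} eq = point-injective
    (trans (sym (point-toCode v)) (trans eq (point-toCode w)))

  toCode-injective : ∀ {v w} → toCode v ≡ toCode w → v P.≈ w
  toCode-injective {v} {w} eq =
    trans (point-toCode v) (trans (cong point eq) (sym (point-toCode w)))

  toCode-⟶ : ∀ {v w} → v P.⟶ w → toCode w ≡ next (proj₂ (toCode v))
  toCode-⟶ {v} {w} eq = point-injective (begin
    point (toCode w)                ≡⟨ point-toCode w ⟨
    proj₁ w                         ≡⟨ eq ⟨
    f (c k e) (proj₁ v)             ≡⟨ f≡F k e (proj₁ v) ⟩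
    F k e (proj₁ v)                 ≡⟨ cong (F k e) (point-toCode v) ⟩
    F k e (point (toCode v))        ≡⟨ f-point (toCode v) ⟩
    point (next (proj₂ (toCode v))) ∎)
    where open ≡-Reasoning

  toCode-⟵ : ∀ {v w} → toCode w ≡ next (proj₂ (toCode v)) → v P.⟶ w
  toCode-⟵ {v} {w} eq = begin
    f (c k e) (proj₁ v)             ≡⟨ f≡F k e (proj₁ v) ⟩
    F k e (proj₁ v)                 ≡⟨ cong (F k e) (point-toCode v) ⟩
    F k e (point (toCode v))        ≡⟨ f-point (toCode v) ⟩
    point (next (proj₂ (toCode v))) ≡⟨ cong point eq ⟨
    point (toCode w)                ≡⟨ point-toCode w ⟨
    proj₁ w                         ∎
    where open ≡-Reasoning

  decode-injective : ∀ {p q} → decode p ≈ decode q → p ≡ q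
  decode-injective {p} {q} eq =
    trans (sym (code-decode p)) (trans (code-cong eq) (code-decode q))

  decode-⟶ : ∀ p → decode p ⟶ decode (next (proj₂ p))
  decode-⟶ p = subst (λ q → decode p ⟶ decode (next (proj₂ q))) (code-decode p) (arrow (decode p))

  -- Both graphs are compared with the codes. On either side an arrow says exactly that the code of
  -- its head is `next` of the index of its tail, so preserving and reflecting arrows become
  -- equalities of codes.
  PrePer≅ : PrePer (c k e) ≅ G
  PrePer≅ = (λ v → decode (toCode v)) , record
    { isOrderMonomorphism = record
      { isOrderHomomorphism = record
        { cong = λ {v} {w} eq → V.reflexive (cong decode (toCode-cong {v} {w} eq))
        ; mono = λ {v} {w} eq → subst (λ q → decode (toCode v) ⟶ decode q)
                   (sym (toCode-⟶ {v} {w} eq)) (decode-⟶ (toCode v))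
        }
      ; injective = λ {v} {w} eq → toCode-injective {v} {w} (decode-injective eq)
      ; cancel    = λ {v} {w} eq → toCode-⟵ {v} {w} (begin
          toCode w                                          ≡⟨ code-decode (toCode w) ⟨
          code (decode (toCode w))                          ≡⟨ arrow-code eq ⟩
          next (proj₂ (code (decode (toCode v))))           ≡⟨ cong (λ q → next (proj₂ q)) (code-decode (toCode v)) ⟩
          next (proj₂ (toCode v))                           ∎)
      }
    ; surjective = λ v → (point (code v) , fromPP k e {point (code v)} (point-preperiodic (code v))) , λ {w} eq →
        V.trans (V.reflexive (cong decode (point-injective
          (trans (sym (point-toCode w)) eq)))) (decode-code v)
    }
    where open ≡-Reasoning

-- Parity and the window of admissible indices.

2∣n*n⇒2∣n : ∀ {n} → 2 ∣ n * n → 2 ∣ n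
2∣n*n⇒2∣n {n} 2∣n² with euclidsLemma n n prime[2] 2∣n²
... | inj₁ 2∣n = 2∣n
... | inj₂ 2∣n = 2∣n

private
  half : ∀ {m d X Y} → (m + d) * (m + d) + 2 * X ≡ m * m + 2 * Y → ∃ λ i → d ≡ 2 * i
  half {m} {d} {X} {Y} eq with 2∣n*n⇒2∣n (ℕ.∣m+n∣m⇒∣n
         (subst (2 ∣_) (sym (ℕ.+-cancelˡ-≡ (m * m) _ _ (trans (sym (expand m d X)) eq))) (ℕ.m∣m*n Y))
         (ℕ.m∣m*n (m * d + X)))
    where
    expand : ∀ m d X → (m + d) * (m + d) + 2 * X ≡ m * m + (2 * (m * d + X) + d * d)
    expand = ℕ.solve-∀
  ... | ℕ.divides i d≡i*2 = i , trans d≡i*2 (ℕ.*-comm i 2)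

-- Writing the larger of `N` and `L` as the smaller plus `d`, the equation makes `d²` even.
squares-same-parity : ∀ {N L X Y} → N * N + 2 * X ≡ L * L + 2 * Y →
  (∃ λ i → N ≡ L + 2 * i) ⊎ (∃ λ j → L ≡ N + 2 * suc j)
squares-same-parity {N} {L} {X} {Y} eq with ℕ.≤-total L N
... | inj₁ L≤N with ℕ.m≤n⇒∃[o]m+o≡n L≤N
...   | d , refl with half {L} {d} {X} {Y} eq
...     | i , refl = inj₁ (i , refl)
squares-same-parity {N} {L} {X} {Y} eq | inj₂ N≤L with ℕ.m≤n⇒∃[o]m+o≡n N≤L
...   | d , refl with half {N} {d} {Y} {X} (sym eq)
-- The case `N = L` also arrives here. It counts as index 0, so that the second alternative means
-- `N < L` strictly.
...     | zero  , refl = inj₁ (0 , sym (trans (ℕ.+-identityʳ (N + 0)) (ℕ.+-identityʳ N)))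
...     | suc j , refl = inj₂ (j , refl)

-- The equation Step (L² + 2qR) (2q) N s M for N = L + 2i, with L² cancelled and divided by 2.
Reduced : (q L R i : ℕ) → Sign → ℕ → Set
Reduced q L R i Sign.+ M = 2 * (i * (L + i)) ≡ q * (R + M)
Reduced q L R i Sign.- M = 2 * (i * (L + i)) + q * M ≡ q * R

private
  expand : ∀ L i → (L + 2 * i) * (L + 2 * i) ≡ L * L + 2 * (2 * (i * (L + i)))
  expand = ℕ.solve-∀

  collect : ∀ L q R M → L * L + 2 * (q * R) + 2 * q * M ≡ L * L + 2 * (q * (R + M))
  collect = ℕ.solve-∀

  collect′ : ∀ L X q M → L * L + 2 * X + 2 * q * M ≡ L * L + 2 * (X + q * M)
  collect′ = ℕ.solve-∀

reduced⇒step : ∀ {q L R i} s {M} → Reduced q L R i s M →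
               Step (L * L + 2 * (q * R)) (2 * q) (L + 2 * i) s M
reduced⇒step {q} {L} {R} {i} Sign.+ {M} eq = begin
  (L + 2 * i) * (L + 2 * i)              ≡⟨ expand L i ⟩
  L * L + 2 * (2 * (i * (L + i)))        ≡⟨ cong (λ t → L * L + 2 * t) eq ⟩
  L * L + 2 * (q * (R + M))              ≡⟨ collect L q R M ⟨
  L * L + 2 * (q * R) + 2 * q * M        ∎
  where open ≡-Reasoning
reduced⇒step {q} {L} {R} {i} Sign.- {M} eq = begin
  (L + 2 * i) * (L + 2 * i) + 2 * q * M            ≡⟨ cong (_+ 2 * q * M) (expand L i) ⟩
  L * L + 2 * (2 * (i * (L + i))) + 2 * q * M      ≡⟨ collect′ L (2 * (i * (L + i))) q M ⟩
  L * L + 2 * (2 * (i * (L + i)) + q * M)          ≡⟨ cong (λ t → L * L + 2 * t) eq ⟩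
  L * L + 2 * (q * R)                              ∎
  where open ≡-Reasoning

step⇒reduced : ∀ {q L R i} s {M} → Step (L * L + 2 * (q * R)) (2 * q) (L + 2 * i) s M →
               Reduced q L R i s M
step⇒reduced {q} {L} {R} {i} Sign.+ {M} eq = ℕ.*-cancelˡ-≡ _ _ 2 (ℕ.+-cancelˡ-≡ (L * L) _ _
  (trans (sym (expand L i)) (trans eq (collect L q R M))))
step⇒reduced {q} {L} {R} {i} Sign.- {M} eq = ℕ.*-cancelˡ-≡ _ _ 2 (ℕ.+-cancelˡ-≡ (L * L) _ _
  (trans (sym (collect′ L (2 * (i * (L + i))) q M)) (trans (cong (_+ 2 * q * M) (sym (expand L i))) eq)))

-- `low` and `top` are escape conditions at the two ends. `low` says that `N = L − 2` is sent beyond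
-- `L + 2h` in absolute value; `top` says that index `h + 1` moves strictly outwards.
module Window (q L R h : ℕ) .{{_ : NonZero q}} (q≤L : q ≤ L)
  (low : q * (L + 2 * h) + 2 < q * R + 2 * L)
  (top : q * (R + (L + 2 * suc h)) < 2 * (suc h * (L + suc h)))
  where
  k e : ℕ
  k = L * L + 2 * (q * R)
  e = 2 * q

  step-parity : ∀ {N} s {M} → Step k e N s M →
                (∃ λ i → N ≡ L + 2 * i) ⊎ (∃ λ j → L ≡ N + 2 * suc j)
  step-parity {N} Sign.+ {M} eq = squares-same-parity {N} {L} {0} {q * (R + M)}
    (trans (ℕ.+-identityʳ (N * N)) (trans eq (collect L q R M)))
  step-parity {N} Sign.- {M} eq = squares-same-parity {N} {L} {q * M} {q * R}
    (trans (cong (λ t → N * N + t) (sym (ℕ.*-assoc 2 q M))) eq)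

  -- A plus sign would need `N² ≥ k > N²`. With a minus sign, `qM = qR + 2(j + 1)(N + j + 1)` and
  -- `(j + 1)(N + j + 1) = L − 1 + j(N + j)`, so the worst case is `j = 0`, which `low` covers.
  below⇒above : ∀ {N} j s {M} → L ≡ N + 2 * suc j → Step k e N s M → L + 2 * h < M
  below⇒above {N} j Sign.+ {M} L≡ eq = ⊥-elim (ℕ.<-irrefl eq (begin-strict
    N * N                            <⟨ ℕ.*-mono-< N<L N<L ⟩
    L * L                            ≤⟨ ℕ.m≤m+n (L * L) (2 * (q * R)) ⟩
    L * L + 2 * (q * R)              ≤⟨ ℕ.m≤m+n k (e * M) ⟩
    L * L + 2 * (q * R) + 2 * q * M  ∎))
    where
    open ℕ.≤-Reasoning
    N<L : N < L
    N<L = subst (N <_) (sym L≡) (ℕ.m<m+n N ℕ.z<s)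
  below⇒above {N} j Sign.- {M} refl eq = ℕ.*-cancelˡ-< q _ _ (ℕ.+-cancelʳ-< 2 _ _ (begin-strict
    q * (L + 2 * h) + 2                      <⟨ low ⟩
    q * R + 2 * (N + 2 * suc j)              ≤⟨ ℕ.m≤m+n _ (2 * (j * (N + j))) ⟩
    q * R + 2 * (N + 2 * suc j) + 2 * (j * (N + j))  ≡⟨ rearrange (q * R) N j ⟩
    q * R + 2 * (suc j * (N + suc j)) + 2    ≡⟨ cong (_+ 2) qM ⟨
    q * M + 2                                ∎))
    where
    open ℕ.≤-Reasoning
    rearrange : ∀ r N j → r + 2 * (N + 2 * (1 + j)) + 2 * (j * (N + j))
                ≡ r + 2 * ((1 + j) * (N + (1 + j))) + 2
    rearrange = ℕ.solve-∀
    expandL : ∀ N j r → (N + 2 * (1 + j)) * (N + 2 * (1 + j)) + 2 * r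
              ≡ N * N + 2 * (r + 2 * ((1 + j) * (N + (1 + j))))
    expandL = ℕ.solve-∀
    qM : q * M ≡ q * R + 2 * (suc j * (N + suc j))
    qM = ℕ.*-cancelˡ-≡ _ _ 2 (ℕ.+-cancelˡ-≡ (N * N) _ _
      (trans (cong (λ t → N * N + t) (sym (ℕ.*-assoc 2 q M))) (trans eq (expandL N j (q * R)))))

  -- Raising `i` by 1 adds `2q` on the left and `2(L + 2i + 1)` on the right, and `q ≤ L`.
  above-top : ∀ d → let i = suc h + d in q * (R + (L + 2 * i)) < 2 * (i * (L + i))
  above-top zero = subst (λ t → q * (R + (L + 2 * suc t)) < 2 * (suc t * (L + suc t)))
    (sym (ℕ.+-identityʳ h)) top
  above-top (suc d) = begin-strict
    q * (R + (L + 2 * (suc h + suc d)))   ≡⟨ cong (λ t → q * (R + (L + 2 * t))) (ℕ.+-suc (suc h) d) ⟩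
    q * (R + (L + 2 * suc i))             ≡⟨ lhs q R L i ⟩
    q * (R + (L + 2 * i)) + 2 * q         <⟨ ℕ.+-monoˡ-< (2 * q) (above-top d) ⟩
    2 * (i * (L + i)) + 2 * q             ≤⟨ ℕ.+-monoʳ-≤ (2 * (i * (L + i))) (ℕ.*-monoʳ-≤ 2 q≤L) ⟩
    2 * (i * (L + i)) + 2 * L             ≤⟨ ℕ.m≤m+n _ (2 * (1 + 2 * i)) ⟩
    2 * (i * (L + i)) + 2 * L + 2 * (1 + 2 * i)   ≡⟨ rhs L i ⟩
    2 * (suc i * (L + suc i))             ≡⟨ cong (λ t → 2 * (t * (L + t))) (ℕ.+-suc (suc h) d) ⟨
    2 * ((suc h + suc d) * (L + (suc h + suc d)))  ∎
    where
    open ℕ.≤-Reasoning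
    i = suc h + d
    lhs : ∀ q R L i → q * (R + (L + 2 * (1 + i))) ≡ q * (R + (L + 2 * i)) + 2 * q
    lhs = ℕ.solve-∀
    rhs : ∀ L i → 2 * (i * (L + i)) + 2 * L + 2 * (1 + 2 * i) ≡ 2 * ((1 + i) * (L + (1 + i)))
    rhs = ℕ.solve-∀

  growth : ∀ {i} → h < i → q * (R + (L + 2 * i)) < 2 * (i * (L + i))
  growth h<i with ℕ.m≤n⇒∃[o]m+o≡n h<i
  ... | d , refl = above-top d

  -- Since `2i(L + i)` exceeds `q(R + N)`, a plus sign gives `M > N`, while a minus sign would need
  -- `2i(L + i) ≤ qR`.
  above-grows : ∀ {N s M} → L + 2 * h < N → Step k e N s M → N < M
  above-grows {N} {s} {M} T<N st with step-parity s st
  ... | inj₂ (j , refl) = ⊥-elim (ℕ.<-asym T<N (ℕ.<-≤-trans (ℕ.m<m+n N ℕ.z<s) (ℕ.m≤m+n L (2 * h))))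
  ... | inj₁ (i , refl) = go s (step⇒reduced {q} {L} {R} {i} s st)
    where
    open ℕ.≤-Reasoning
    grown = growth (ℕ.*-cancelˡ-< 2 h i (ℕ.+-cancelˡ-< L _ _ T<N))
    go : ∀ s → Reduced q L R i s M → N < M
    go Sign.+ eq = ℕ.+-cancelˡ-< R _ _ (ℕ.*-cancelˡ-< q _ _ (subst (q * (R + N) <_) eq grown))
    go Sign.- eq = ⊥-elim (ℕ.<-irrefl refl (begin-strict
      q * R                            ≤⟨ ℕ.*-monoʳ-≤ q (ℕ.m≤m+n R N) ⟩
      q * (R + N)                      <⟨ grown ⟩
      2 * (i * (L + i))                ≤⟨ ℕ.m≤m+n _ (q * M) ⟩
      2 * (i * (L + i)) + q * M        ≡⟨ eq ⟩
      q * R                            ∎))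

  module _ {B : ℕ → Set} (T : Trapped k e B) where
    open Trapped T

    ≤top : ∀ {N} → B N → N ≤ L + 2 * h
    ≤top BN = ℕ.≮⇒≥ (escapes (L + 2 * h <_)
      (λ {N} {s} {M} T<N st → let N<M = above-grows {N} {s} {M} T<N st in ℕ.<-trans T<N N<M , N<M) BN)

    -- The lower end needs a single step: from below `L` the image lands above the top, where
    -- nothing is preperiodic.
    index : ∀ {N} → B N → ∃ λ i → N ≡ L + 2 * i × i ≤ h
    index BN with step BN
    ... | s , M , BM , st with step-parity s st
    ...   | inj₁ (i , refl) = i , refl , ℕ.*-cancelˡ-≤ 2 (ℕ.+-cancelˡ-≤ L _ _ (≤top BN))
    ...   | inj₂ (j , L≡)   = ⊥-elim (ℕ.<⇒≱ (below⇒above j s L≡ st) (≤top BM))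

    next-index : ∀ {i} → B (L + 2 * i) → ∃ λ s → ∃ λ j →
                 j ≤ h × B (L + 2 * j) × Reduced q L R i s (L + 2 * j)
    next-index {i} Bi with step Bi
    ... | s , M , BM , st with index BM
    ...   | j , refl , j≤h = s , j , j≤h , BM , step⇒reduced {q} {L} {R} {i} s st

-- The six graphs coded by signs and indices.

-- In all six codings the indices increase with the absolute numerator, so `0F` stands for `±L`, and
-- the signs are those of the actual points.
symmetric4⟨1,1⟩ : Symmetric G4⟨1,1⟩ 2
symmetric4⟨1,1⟩ = record
  { next        = λ { 0F → Sign.- , 0F ; 1F → Sign.+ , 1F }
  ; code        = λ { a → Sign.- , 0F ; a′ → Sign.+ , 0F ; b → Sign.+ , 1F ; b′ → Sign.- , 1F }
  ; decode      = λ { (Sign.- , 0F) → a ; (Sign.+ , 0F) → a′ ; (Sign.+ , 1F) → b ; (Sign.- , 1F) → b′ }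
  ; code-cong   = cong _
  ; code-decode = λ { (Sign.- , 0F) → refl ; (Sign.+ , 0F) → refl ; (Sign.+ , 1F) → refl ; (Sign.- , 1F) → refl }
  ; decode-code = λ { a → refl ; a′ → refl ; b → refl ; b′ → refl }
  ; arrow       = λ { a → a→a ; a′ → a′→a ; b → b→b ; b′ → b′→b }
  ; arrow-code  = λ { a→a → refl ; a′→a → refl ; b→b → refl ; b′→b → refl }
  }

symmetric4⟨2⟩ : Symmetric G4⟨2⟩ 2
symmetric4⟨2⟩ = record
  { next        = λ { 0F → Sign.- , 1F ; 1F → Sign.+ , 0F }
  ; code        = λ { x → Sign.+ , 0F ; y → Sign.- , 1F ; x′ → Sign.- , 0F ; y′ → Sign.+ , 1F }
  ; decode      = λ { (Sign.+ , 0F) → x ; (Sign.- , 1F) → y ; (Sign.- , 0F) → x′ ; (Sign.+ , 1F) → y′ }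
  ; code-cong   = cong _
  ; code-decode = λ { (Sign.- , 0F) → refl ; (Sign.+ , 0F) → refl ; (Sign.+ , 1F) → refl ; (Sign.- , 1F) → refl }
  ; decode-code = λ { x → refl ; y → refl ; x′ → refl ; y′ → refl }
  ; arrow       = λ { x → x→y ; y → y→x ; x′ → x′→y ; y′ → y′→x }
  ; arrow-code  = λ { x→y → refl ; y→x → refl ; x′→y → refl ; y′→x → refl }
  }

symmetric6⟨1,1⟩ : Symmetric G6⟨1,1⟩ 3
symmetric6⟨1,1⟩ = record
  { next        = λ { 0F → Sign.- , 2F ; 1F → Sign.- , 1F ; 2F → Sign.+ , 2F }
  ; code        = λ { a → Sign.+ , 2F ; a′ → Sign.- , 2F ; b → Sign.- , 1F ; b′ → Sign.+ , 1F
                    ; u → Sign.+ , 0F ; u′ → Sign.- , 0F }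
  ; decode      = λ { (Sign.+ , 2F) → a ; (Sign.- , 2F) → a′ ; (Sign.- , 1F) → b ; (Sign.+ , 1F) → b′
                    ; (Sign.+ , 0F) → u ; (Sign.- , 0F) → u′ }
  ; code-cong   = cong _
  ; code-decode = λ { (Sign.+ , 2F) → refl ; (Sign.- , 2F) → refl ; (Sign.- , 1F) → refl
                    ; (Sign.+ , 1F) → refl ; (Sign.+ , 0F) → refl ; (Sign.- , 0F) → refl }
  ; decode-code = λ { a → refl ; a′ → refl ; b → refl ; b′ → refl ; u → refl ; u′ → refl }
  ; arrow       = λ { a → a→a ; a′ → a′→a ; b → b→b ; b′ → b′→b ; u → u→a′ ; u′ → u′→a′ }
  ; arrow-code  = λ { a→a → refl ; a′→a → refl ; b→b → refl ; b′→b → refl ; u→a′ → refl ; u′→a′ → refl }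
  }

symmetric6⟨2⟩ : Symmetric G6⟨2⟩ 3
symmetric6⟨2⟩ = record
  { next        = λ { 0F → Sign.- , 2F ; 1F → Sign.- , 0F ; 2F → Sign.+ , 0F }
  ; code        = λ { x → Sign.+ , 0F ; y → Sign.- , 2F ; x′ → Sign.- , 0F ; y′ → Sign.+ , 2F
                    ; u → Sign.+ , 1F ; u′ → Sign.- , 1F }
  ; decode      = λ { (Sign.+ , 0F) → x ; (Sign.- , 2F) → y ; (Sign.- , 0F) → x′ ; (Sign.+ , 2F) → y′
                    ; (Sign.+ , 1F) → u ; (Sign.- , 1F) → u′ }
  ; code-cong   = cong _
  ; code-decode = λ { (Sign.+ , 2F) → refl ; (Sign.- , 2F) → refl ; (Sign.- , 1F) → refl
                    ; (Sign.+ , 1F) → refl ; (Sign.+ , 0F) → refl ; (Sign.- , 0F) → refl }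
  ; decode-code = λ { x → refl ; y → refl ; x′ → refl ; y′ → refl ; u → refl ; u′ → refl }
  ; arrow       = λ { x → x→y ; y → y→x ; x′ → x′→y ; y′ → y′→x ; u → u→x′ ; u′ → u′→x′ }
  ; arrow-code  = λ { x→y → refl ; y→x → refl ; x′→y → refl ; y′→x → refl ; u→x′ → refl ; u′→x′ → refl }
  }

symmetric6⟨3⟩ : Symmetric G6⟨3⟩ 3
symmetric6⟨3⟩ = record
  { next        = λ { 0F → Sign.- , 2F ; 1F → Sign.+ , 0F ; 2F → Sign.+ , 1F }
  ; code        = λ { x → Sign.+ , 0F ; y → Sign.- , 2F ; z → Sign.+ , 1F
                    ; x′ → Sign.- , 0F ; y′ → Sign.+ , 2F ; z′ → Sign.- , 1F }
  ; decode      = λ { (Sign.+ , 0F) → x ; (Sign.- , 2F) → y ; (Sign.+ , 1F) → z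
                    ; (Sign.- , 0F) → x′ ; (Sign.+ , 2F) → y′ ; (Sign.- , 1F) → z′ }
  ; code-cong   = cong _
  ; code-decode = λ { (Sign.+ , 2F) → refl ; (Sign.- , 2F) → refl ; (Sign.- , 1F) → refl
                    ; (Sign.+ , 1F) → refl ; (Sign.+ , 0F) → refl ; (Sign.- , 0F) → refl }
  ; decode-code = λ { x → refl ; y → refl ; z → refl ; x′ → refl ; y′ → refl ; z′ → refl }
  ; arrow       = λ { x → x→y ; y → y→z ; z → z→x ; x′ → x′→y ; y′ → y′→z ; z′ → z′→x }
  ; arrow-code  = λ { x→y → refl ; y→z → refl ; z→x → refl ; x′→y → refl ; y′→z → refl ; z′→x → refl }
  }

symmetric8⟨2,1,1⟩ : Symmetric G8⟨2,1,1⟩ 4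
symmetric8⟨2,1,1⟩ = record
  { next        = λ { 0F → Sign.- , 2F ; 1F → Sign.- , 1F ; 2F → Sign.+ , 0F ; 3F → Sign.+ , 3F }
  ; code        = λ { (inj₁ x) → Sign.+ , 0F ; (inj₁ y) → Sign.- , 2F
                    ; (inj₁ x′) → Sign.- , 0F ; (inj₁ y′) → Sign.+ , 2F
                    ; (inj₂ a) → Sign.- , 1F ; (inj₂ a′) → Sign.+ , 1F
                    ; (inj₂ b) → Sign.+ , 3F ; (inj₂ b′) → Sign.- , 3F }
  ; decode      = λ { (Sign.+ , 0F) → inj₁ x ; (Sign.- , 2F) → inj₁ y
                    ; (Sign.- , 0F) → inj₁ x′ ; (Sign.+ , 2F) → inj₁ y′
                    ; (Sign.- , 1F) → inj₂ a ; (Sign.+ , 1F) → inj₂ a′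
                    ; (Sign.+ , 3F) → inj₂ b ; (Sign.- , 3F) → inj₂ b′ }
  ; code-cong   = λ { (inj₁ refl) → refl ; (inj₂ refl) → refl }
  ; code-decode = λ { (Sign.+ , 0F) → refl ; (Sign.- , 2F) → refl ; (Sign.- , 0F) → refl
                    ; (Sign.+ , 2F) → refl ; (Sign.- , 1F) → refl ; (Sign.+ , 1F) → refl
                    ; (Sign.+ , 3F) → refl ; (Sign.- , 3F) → refl }
  ; decode-code = λ { (inj₁ x) → inj₁ refl ; (inj₁ y) → inj₁ refl
                    ; (inj₁ x′) → inj₁ refl ; (inj₁ y′) → inj₁ refl
                    ; (inj₂ a) → inj₂ refl ; (inj₂ a′) → inj₂ refl
                    ; (inj₂ b) → inj₂ refl ; (inj₂ b′) → inj₂ refl }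
  ; arrow       = λ { (inj₁ x) → inj₁ x→y ; (inj₁ y) → inj₁ y→x
                    ; (inj₁ x′) → inj₁ x′→y ; (inj₁ y′) → inj₁ y′→x
                    ; (inj₂ a) → inj₂ a→a ; (inj₂ a′) → inj₂ a′→a
                    ; (inj₂ b) → inj₂ b→b ; (inj₂ b′) → inj₂ b′→b }
  ; arrow-code  = λ { (inj₁ x→y) → refl ; (inj₁ y→x) → refl ; (inj₁ x′→y) → refl ; (inj₁ y′→x) → refl
                    ; (inj₂ a→a) → refl ; (inj₂ a′→a) → refl ; (inj₂ b→b) → refl ; (inj₂ b′→b) → refl }
  }

-- Divisibility by powers of 3.

prime[3] : Prime 3
prime[3] = toWitness {a? = prime? 3} _

3^s∣m*n⇒3^s∣m : ∀ s {m n} → ¬ 3 ∣ n → 3 ^ s ∣ m * n → 3 ^ s ∣ m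
3^s∣m*n⇒3^s∣m zero            3∤n _ = ℕ.1∣ _
3^s∣m*n⇒3^s∣m (suc s) {m} {n} 3∤n 3^s∣mn
  with euclidsLemma m n prime[3] (ℕ.∣-trans (ℕ.m∣m*n (3 ^ s)) 3^s∣mn)
... | inj₂ 3∣n = ⊥-elim (3∤n 3∣n)
... | inj₁ (ℕ.divides m′ refl) = subst (3 * 3 ^ s ∣_) (ℕ.*-comm 3 m′)
        (ℕ.*-monoʳ-∣ 3 (3^s∣m*n⇒3^s∣m s {m′} 3∤n
          (ℕ.*-cancelˡ-∣ 3 (subst (3 * 3 ^ s ∣_) (rearrange m′ n) 3^s∣mn))))
  where
  rearrange : ∀ m n → m * 3 * n ≡ 3 * (m * n)
  rearrange = ℕ.solve-∀

PowerOf3 : ℕ → Set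
PowerOf3 n = ∃ λ s → n ≡ 3 ^ s

-- 3 divides at most one of two consecutive numbers and does not divide 2, so the whole power sits
-- in one factor.
∣2[n+1]n : ∀ {m n} → PowerOf3 m → m ∣ 2 * (suc n * n) → (m ∣ suc n) ⊎ (m ∣ n)
∣2[n+1]n {n = n} (s , refl) m∣ with 3 ∣? n
... | no 3∤n  = inj₁ (3^s∣m*n⇒3^s∣m s 3∤n m∣[n+1]n)
  where
  m∣[n+1]n = 3^s∣m*n⇒3^s∣m s {n = 2} (toWitnessFalse {a? = 3 ∣? 2} _)
    (subst (3 ^ s ∣_) (ℕ.*-comm 2 (suc n * n)) m∣)
... | yes 3∣n = inj₂ (3^s∣m*n⇒3^s∣m s 3∤n+1 (subst (3 ^ s ∣_) (ℕ.*-comm (suc n) n) m∣[n+1]n))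
  where
  m∣[n+1]n = 3^s∣m*n⇒3^s∣m s {n = 2} (toWitnessFalse {a? = 3 ∣? 2} _)
    (subst (3 ^ s ∣_) (ℕ.*-comm 2 (suc n * n)) m∣)
  3∤n+1 : ¬ 3 ∣ suc n
  3∤n+1 3∣n+1 = toWitnessFalse {a? = 3 ∣? 1} _
    (ℕ.∣m+n∣m⇒∣n (subst (3 ∣_) (ℕ.+-comm 1 n) 3∣n+1) 3∣n)

-- The witness is `n = 3^(4 + t) − 4`. The shift allows the families with a parameter `m` to be
-- written in `n` through `m = 4 + n`, which is at least 4.
powers-unbounded : ∀ t → ∃ λ n → t ≤ n × PowerOf3 (4 + n)
powers-unbounded t with ℕ.m≤n⇒∃[o]m+o≡n (n<3^n (4 + t))
  where
  open ℕ.≤-Reasoning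
  n<3^n : ∀ n → n < 3 ^ n
  n<3^n zero    = ℕ.z<s
  n<3^n (suc n) = begin-strict
    suc n            ≤⟨ n<3^n n ⟩
    3 ^ n            <⟨ ℕ.m<m+n (3 ^ n) (ℕ.<-≤-trans (ℕ.≤-<-trans ℕ.z≤n (n<3^n n)) (ℕ.m≤m+n (3 ^ n) _)) ⟩
    3 ^ suc n        ∎
... | o , eq = suc t + o , ℕ.≤-trans (ℕ.n≤1+n t) (ℕ.m≤m+n (suc t) o) , 4 + t , eq

small-multiple : ∀ {m n} → m ∣ n → n < 2 * m → n ≡ 0 ⊎ n ≡ m
small-multiple     (ℕ.divides 0 eq)             _    = inj₁ eq
small-multiple {m} (ℕ.divides 1 eq)             _    = inj₂ (trans eq (ℕ.*-identityˡ m))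
small-multiple {m} (ℕ.divides (suc (suc k)) refl) n<2m =
  ⊥-elim (ℕ.<⇒≱ n<2m (ℕ.*-monoˡ-≤ m (s≤s (s≤s (z≤n {k})))))

-- Modulo `m` the factor `L + n + 1` is `n`, because `m` divides `L + 1`.
∣2[n+1][L+n+1] : ∀ {m L} n → m ∣ suc L → m ∣ 2 * (suc n * (L + suc n)) → m ∣ 2 * (suc n * n)
∣2[n+1][L+n+1] {m} {L} n m∣L+1 m∣ =
  ℕ.∣m+n∣m⇒∣n (subst (m ∣_) (split n L) m∣) (ℕ.∣n⇒∣m*n (2 * suc n) m∣L+1)
  where
  split : ∀ n L → 2 * ((1 + n) * (L + (1 + n))) ≡ 2 * (1 + n) * (1 + L) + 2 * ((1 + n) * n)
  split = ℕ.solve-∀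

-- `m` divides `i` or `i − 1`, and the only multiples of `m` below `2m` are 0 and `m`.
small-index : ∀ {m L i} → PowerOf3 m → m ∣ suc L → m ∣ 2 * (i * (L + i)) → i < 2 * m →
              i ≡ 0 ⊎ i ≡ 1 ⊎ i ≡ m ⊎ i ≡ suc m
small-index {i = zero}  _  _     _  _    = inj₁ refl
small-index {i = suc n} m3 m∣L+1 m∣ i<2m with ∣2[n+1]n m3 (∣2[n+1][L+n+1] n m∣L+1 m∣)
... | inj₁ m∣n+1 with small-multiple m∣n+1 i<2m
...   | inj₂ n+1≡m = inj₂ (inj₂ (inj₁ n+1≡m))
small-index {i = suc n} m3 m∣L+1 m∣ i<2m | inj₂ m∣n with small-multiple m∣n (ℕ.<-trans (ℕ.n<1+n n) i<2m)
...   | inj₁ n≡0 = inj₂ (inj₁ (cong suc n≡0))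
...   | inj₂ n≡m = inj₂ (inj₂ (inj₂ (cong suc n≡m)))

reduced⇒∣ : ∀ {q L R i} s {M} → Reduced q L R i s M → q ∣ 2 * (i * (L + i))
reduced⇒∣ {q} {R = R} Sign.+ {M} eq = subst (q ∣_) (sym eq) (ℕ.m∣m*n (R + M))
reduced⇒∣ {q} {L} {R} {i} Sign.- {M} eq =
  ℕ.∣m+n∣m⇒∣n (subst (q ∣_) (trans (sym eq) (ℕ.+-comm (2 * (i * (L + i))) (q * M))) (ℕ.m∣m*n R)) (ℕ.m∣m*n M)

≤-by : ∀ {m n} d → m + d ≡ n → m ≤ n
≤-by {m} d refl = ℕ.m≤m+n m d

<-by : ∀ {m n} d → suc m + d ≡ n → m < n
<-by = ≤-by

-- From a one-parameter family to infinitely many `c`.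

module _ {G r} (sym-G : Symmetric G r) (q L R h : ℕ → ℕ)
  (q≢0 : ∀ n → NonZero (q n))
  (q≤L : ∀ n → q n ≤ L n)
  (low : ∀ n → q n * (L n + 2 * h n) + 2 < q n * R n + 2 * L n)
  (top : ∀ n → q n * (R n + (L n + 2 * suc (h n))) < 2 * (suc (h n) * (L n + suc (h n))))
  (large : ∀ n → n * (2 * q n * (2 * q n)) ≤ L n * L n + 2 * (q n * R n))
  (idx : ℕ → Fin r → ℕ)
  (idx-injective : ∀ n {i j} → idx n i ≡ idx n j → i ≡ j)
  (steps : ∀ n i → Reduced (q n) (L n) (R n) (idx n i) (proj₁ (Symmetric.next sym-G i))
                     (L n + 2 * idx n (proj₂ (Symmetric.next sym-G i))))
  (complete : ∀ n → PowerOf3 (4 + n) →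
    ∀ {B} → Trapped (L n * L n + 2 * (q n * R n)) (2 * q n) B →
    ∀ {i} → B (L n + 2 * i) → i ≤ h n → ∃ λ j → i ≡ idx n j)
  where

  -- Given `t`, some `n ≥ t` makes `4 + n` a power of 3, and `large` turns `n ≥ t` into `k ≥ t e²`.
  infinite-family : Infinite (λ c → PrePer c ≅ G)
  infinite-family = infinite (λ t → go t (powers-unbounded t))
    where
    go : ∀ t → (∃ λ n → t ≤ n × PowerOf3 (4 + n)) → Σ ℕ λ k → Σ ℕ λ e → Σ (NonZero e) λ nz →
         t * (e * e) ≤ k × PrePer (c⟨_,_⟩ k e {{nz}}) ≅ G
    go t (n , t≤n , n3) = k , e , e≢0 ,
      ℕ.≤-trans (ℕ.*-monoˡ-≤ (e * e) t≤n) (large n) ,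
      PrePer≅ sym-G k e {{e≢0}} (λ i → L n + 2 * idx n i)
        {{ℕ.>-nonZero (ℕ.<-≤-trans (ℕ.<-≤-trans (ℕ.>-nonZero⁻¹ (q n) {{q≢0 n}}) (q≤L n)) (ℕ.m≤m+n (L n) _))}}
        (λ eq → idx-injective n (ℕ.*-cancelˡ-≡ _ _ 2 (ℕ.+-cancelˡ-≡ (L n) _ _ eq)))
        (λ i → reduced⇒step {q n} {L n} {R n} {idx n i} (proj₁ (Symmetric.next sym-G i)) (steps n i))
        classified
      where
      open Window (q n) (L n) (R n) (h n) {{q≢0 n}} (q≤L n) (low n) (top n)

      e≢0 : NonZero e
      e≢0 = ℕ.m*n≢0 2 (q n) {{_}} {{q≢0 n}}

      classified : ∀ {B} → Trapped k e B → ∀ {N} → B N → ∃ λ i → N ≡ L n + 2 * idx n i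
      classified T BN with index T BN
      ... | i , refl , i≤h with complete n n3 T BN i≤h
      ...   | j , i≡ = j , cong (λ t → L n + 2 * t) i≡

module _ {q L R h} .{{_ : NonZero q}} (q≤L : q ≤ L)
  (low : q * (L + 2 * h) + 2 < q * R + 2 * L)
  (top : q * (R + (L + 2 * suc h)) < 2 * (suc h * (L + suc h)))
  {B} (T : Trapped (L * L + 2 * (q * R)) (2 * q) B)
  where
  private module W = Window q L R h q≤L low top

  power-index : PowerOf3 q → q ∣ suc L → h < 2 * q → ∀ {i} → B (L + 2 * i) → i ≤ h →
                i ≡ 0 ⊎ i ≡ 1 ⊎ i ≡ q ⊎ i ≡ suc q
  power-index q3 q∣L+1 h<2q {i} Bi i≤h with W.next-index T {i} Bi
  ... | s , j , _ , _ , red =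
    small-index q3 q∣L+1 (reduced⇒∣ {q} {L} {R} {i} s red) (ℕ.≤-<-trans i≤h h<2q)

  -- From index `q` the step reads `R ± M = 2(L + q)`. The two bounds force the plus sign and
  -- `M < L`, which lies outside the window.
  index≢q : R < 2 * (L + q) → 2 * (L + q) < R + L → ¬ B (L + 2 * q)
  index≢q R< <R+L Bq with W.next-index T {q} Bq
  ... | s , j , _ , _ , red = go s red
    where
    open ℕ.≤-Reasoning
    pull : ∀ q L → 2 * (q * (L + q)) ≡ q * (2 * (L + q))
    pull = ℕ.solve-∀
    go : ∀ s → ¬ Reduced q L R q s (L + 2 * j)
    go Sign.+ eq = ℕ.<⇒≢ (ℕ.<-≤-trans <R+L (ℕ.+-monoʳ-≤ R (ℕ.m≤m+n L (2 * j))))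
      (ℕ.*-cancelˡ-≡ _ _ q (trans (sym (pull q L)) eq))
    go Sign.- eq = ℕ.<-irrefl refl (begin-strict
      q * R                                     <⟨ ℕ.*-monoʳ-< q R< ⟩
      q * (2 * (L + q))                         ≡⟨ pull q L ⟨
      2 * (q * (L + q))                         ≤⟨ ℕ.m≤m+n _ (q * (L + 2 * j)) ⟩
      2 * (q * (L + q)) + q * (L + 2 * j)       ≡⟨ eq ⟩
      q * R                                     ∎)

-- Arithmetic of the 3-cycle family.

-- With q = m (m + 1) and L = m³ − m − 1, m a power of 3, divisibility by m restricts the index
-- modulo m and divisibility by m + 1 excludes the spurious indices.
module Cubic (p : ℕ) where
  m : ℕ
  m = suc p

  opaque
    q L : ℕ
    q = m * suc m
    -- This is (m - 1)m(m + 1) - 1. Thus `q` divides `L + 1`, which gives the congruences modulo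
    -- both `m` and `m + 1`.
    L = ℕ.pred (q * p)

    q≡ : q ≡ m * suc m
    q≡ = refl

    instance
      q≢0 : NonZero q
      q≢0 = _

    1<q : 1 < q
    1<q = ℕ.*-mono-≤ {1} {m} {2} {suc m} (s≤s ℕ.z≤n) (s≤s (s≤s ℕ.z≤n))

    L+1≡ : .{{_ : NonZero p}} → suc L ≡ q * p
    L+1≡ = ℕ.suc-pred (q * p) {{ℕ.m*n≢0 q p}}

  -- Equal to (m + 1)², the largest index on the 3-cycle.
  h : ℕ
  h = q + suc m

  m∣q : m ∣ q
  m∣q = subst (m ∣_) (sym q≡) (ℕ.m∣m*n (suc m))

  m+1∣q : suc m ∣ q
  m+1∣q = subst (suc m ∣_) (sym q≡) (ℕ.n∣m*n m)

  R : ℕ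
  R = L + 2 * h

  q+1≢h : suc q ≢ h
  q+1≢h eq with ℕ.+-cancelˡ-≡ q 1 (suc m) (trans (ℕ.+-comm q 1) eq)
  ... | ()

  -- The 3-cycle is `L → −(L + 2h) → L + 2(q + 1) → L`; its arrows are `step₀`, `step₂` and `step₁`
  -- in this order.
  step₀ : Reduced q L R 0 Sign.- (L + 2 * h)
  step₀ = refl

  module Large (2<p : 2 < p) where
    instance
      p≢0 : NonZero p
      p≢0 = ℕ.>-nonZero (ℕ.<-trans ℕ.z<s 2<p)

    L+suc : ∀ n → L + suc n ≡ q * p + n
    L+suc n = trans (ℕ.+-suc L n) (cong (_+ n) L+1≡)

    step₁ : Reduced q L R (suc q) Sign.+ (L + 2 * 0)
    step₁ = begin
      2 * (suc q * (L + suc q))        ≡⟨ cong (λ t → 2 * (suc q * t)) (L+suc q) ⟩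
      2 * (suc q * (q * p + q))        ≡⟨ regroup q p ⟩
      q * (2 * (suc q * m))            ≡⟨ cong (q *_) (ℕ.+-cancelˡ-≡ 2 _ _ inner) ⟩
      q * (R + (L + 2 * 0))            ∎
      where
      open ≡-Reasoning
      regroup : ∀ q p → 2 * ((1 + q) * (q * p + q)) ≡ q * (2 * ((1 + q) * (1 + p)))
      regroup = ℕ.solve-∀
      left : ∀ q p → 2 + 2 * ((1 + q) * (1 + p)) ≡ q * p + q * p + 2 * (q + (2 + p))
      left = ℕ.solve-∀
      right : ∀ L h → (1 + L) + (1 + L) + 2 * h ≡ 2 + (L + 2 * h + (L + 2 * 0))
      right = ℕ.solve-∀
      inner : 2 + 2 * (suc q * m) ≡ 2 + (R + (L + 2 * 0))
      inner = trans (left q p) (trans (cong (λ t → t + t + 2 * h) (sym L+1≡)) (right L h))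

    step₂ : Reduced q L R h Sign.+ (L + 2 * suc q)
    step₂ = begin
      2 * (h * (L + h))                            ≡⟨ cong (λ t → 2 * (h * (L + t))) (ℕ.+-suc q m) ⟩
      2 * (h * (L + suc (q + m)))                  ≡⟨ cong (λ t → 2 * (h * t)) (L+suc (q + m)) ⟩
      2 * (h * (q * p + (q + m)))                  ≡⟨ identity q≡ ⟩
      q * (q * p + q * p + 2 * h + 2 * q)          ≡⟨ cong (λ t → q * (t + t + 2 * h + 2 * q)) L+1≡ ⟨
      q * (suc L + suc L + 2 * h + 2 * q)          ≡⟨ cong (q *_) (regroup L h q) ⟩
      q * (R + (L + 2 * suc q))                    ∎
      where
      open ≡-Reasoning
      regroup : ∀ L h q → (1 + L) + (1 + L) + 2 * h + 2 * q ≡ L + 2 * h + (L + 2 * (1 + q))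
      regroup = ℕ.solve-∀
      identity : ∀ {q} → q ≡ (1 + p) * (2 + p) →
        2 * ((q + (2 + p)) * (q * p + (q + (1 + p)))) ≡ q * (q * p + q * p + 2 * (q + (2 + p)) + 2 * q)
      identity refl = lemma p
        where
        lemma : ∀ p →
          2 * (((1 + p) * (2 + p) + (2 + p)) * ((1 + p) * (2 + p) * p + ((1 + p) * (2 + p) + (1 + p))))
          ≡ (1 + p) * (2 + p) * ((1 + p) * (2 + p) * p + (1 + p) * (2 + p) * p
            + 2 * ((1 + p) * (2 + p) + (2 + p)) + 2 * ((1 + p) * (2 + p)))
        lemma = ℕ.solve-∀

    q≤L : q ≤ L
    q≤L = ℕ.≤-pred (begin
      1 + q      ≤⟨ ℕ.+-monoˡ-≤ q (ℕ.<⇒≤ 1<q) ⟩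
      q + q      ≡⟨ double q ⟩
      q * 2      ≤⟨ ℕ.*-monoʳ-≤ q (ℕ.<⇒≤ 2<p) ⟩
      q * p      ≡⟨ L+1≡ ⟨
      suc L      ∎)
      where
      open ℕ.≤-Reasoning
      double : ∀ q → q + q ≡ q * 2
      double = ℕ.solve-∀

    low : q * (L + 2 * h) + 2 < q * R + 2 * L
    low = ℕ.+-monoʳ-< (q * R) (ℕ.*-monoʳ-< 2 (ℕ.<-≤-trans 1<q q≤L))

    -- Once `L + 1` is replaced by `q * p`, the two sides differ by exactly `4(m + 1)`.
    top : q * (R + (L + 2 * suc h)) < 2 * (suc h * (L + suc h))
    top = begin-strict
      q * (R + (L + 2 * suc h))                        ≡⟨ regroup q L h ⟩
      2 * (q * suc L) + 4 * (q * h)                    ≡⟨ cong (λ t → 2 * (q * t) + 4 * (q * h)) L+1≡ ⟩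
      2 * (q * (q * p)) + 4 * (q * h)                  <⟨ ℕ.m<m+n _ ℕ.z<s ⟩
      2 * (q * (q * p)) + 4 * (q * h) + 4 * suc m      ≡⟨ identity q≡ ⟩
      2 * (suc h * (q * p + h))                        ≡⟨ cong (λ t → 2 * (suc h * t)) (L+suc h) ⟨
      2 * (suc h * (L + suc h))                        ∎
      where
      open ℕ.≤-Reasoning
      regroup : ∀ q L h → q * (L + 2 * h + (L + 2 * (1 + h))) ≡ 2 * (q * (1 + L)) + 4 * (q * h)
      regroup = ℕ.solve-∀
      identity : ∀ {q} → q ≡ (1 + p) * (2 + p) →
        2 * (q * (q * p)) + 4 * (q * (q + (2 + p))) + 4 * (2 + p)
        ≡ 2 * ((1 + (q + (2 + p))) * (q * p + (q + (2 + p))))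
      identity refl = lemma p
        where
        lemma : ∀ p → 2 * ((1 + p) * (2 + p) * ((1 + p) * (2 + p) * p))
                      + 4 * ((1 + p) * (2 + p) * ((1 + p) * (2 + p) + (2 + p))) + 4 * (2 + p)
                    ≡ 2 * ((1 + ((1 + p) * (2 + p) + (2 + p)))
                      * ((1 + p) * (2 + p) * p + ((1 + p) * (2 + p) + (2 + p))))
        lemma = ℕ.solve-∀

    p²-large : 2 * p + 3 ≤ p * p
    p²-large = begin
      2 * p + 3      ≤⟨ ℕ.+-monoʳ-≤ (2 * p) 2<p ⟩
      2 * p + p      ≡⟨ triple p ⟩
      3 * p          ≤⟨ ℕ.*-monoˡ-≤ p 2<p ⟩
      p * p          ∎
      where
      open ℕ.≤-Reasoning
      triple : ∀ p → 2 * p + p ≡ 3 * p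
      triple = ℕ.solve-∀

    -- Confines the sources of minus steps to `i < 2m`. It amounts to (m + 1)³ < 2(m³ + m - 1),
    -- which fails at m = 3 and holds from m = 4 on, that is for `2 < p`.
    far : q * (2 * h) < 2 * (2 * m * (L + 2 * m))
    far = ℕ.+-cancelʳ-< (4 * m) _ _ (begin-strict
      q * (2 * h) + 4 * m
        ≡⟨ multiply-out q≡ ⟩
      2 * q * (p * p + (2 * p + 3) + 2 * p + 1) + 4 * m
        ≤⟨ ℕ.+-monoˡ-≤ (4 * m) (ℕ.*-monoʳ-≤ (2 * q)
             (ℕ.+-monoˡ-≤ 1 (ℕ.+-monoˡ-≤ (2 * p) (ℕ.+-monoʳ-≤ (p * p) p²-large)))) ⟩
      2 * q * (p * p + p * p + 2 * p + 1) + 4 * m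
        <⟨ ℕ.m<m+n _ {2 * (suc p * (3 * p))} (ℕ.>-nonZero⁻¹ _
             {{ℕ.m*n≢0 2 _ {{_}} {{ℕ.m*n≢0 m _ {{_}} {{ℕ.m*n≢0 3 p}}}}}}) ⟩
      2 * q * (p * p + p * p + 2 * p + 1) + 4 * m + 2 * (suc p * (3 * p))
        ≡⟨ identity q≡ ⟩
      2 * (2 * m * (q * p + 2 * p + 1)) + 4 * m
        ≡⟨ cong (λ t → 2 * (2 * m * t) + 4 * m) (trans (ℕ.+-assoc (q * p) (2 * p) 1)
             (sym (trans (cong (λ t → L + t) (twice p)) (L+suc (2 * p + 1))))) ⟩
      2 * (2 * m * (L + 2 * m)) + 4 * m
        ∎)
      where
      open ℕ.≤-Reasoning
      twice : ∀ p → 2 * (1 + p) ≡ 1 + (2 * p + 1)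
      twice = ℕ.solve-∀
      multiply-out : ∀ {q} → q ≡ (1 + p) * (2 + p) →
        q * (2 * (q + (2 + p))) + 4 * (1 + p) ≡ 2 * q * (p * p + (2 * p + 3) + 2 * p + 1) + 4 * (1 + p)
      multiply-out refl = lemma p
        where
        lemma : ∀ p → (1 + p) * (2 + p) * (2 * ((1 + p) * (2 + p) + (2 + p))) + 4 * (1 + p)
                    ≡ 2 * ((1 + p) * (2 + p)) * (p * p + (2 * p + 3) + 2 * p + 1) + 4 * (1 + p)
        lemma = ℕ.solve-∀
      identity : ∀ {q} → q ≡ (1 + p) * (2 + p) →
        2 * q * (p * p + p * p + 2 * p + 1) + 4 * (1 + p) + 2 * ((1 + p) * (3 * p))
        ≡ 2 * (2 * (1 + p) * (q * p + 2 * p + 1)) + 4 * (1 + p)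
      identity refl = lemma p
        where
        lemma : ∀ p → 2 * ((1 + p) * (2 + p)) * (p * p + p * p + 2 * p + 1) + 4 * (1 + p) + 2 * ((1 + p) * (3 * p))
                    ≡ 2 * (2 * (1 + p) * ((1 + p) * (2 + p) * p + 2 * p + 1)) + 4 * (1 + p)
        lemma = ℕ.solve-∀

    -- `k` is at least `(L + 1)² = (qp)²`, while `n e² = 4n q²`.
    large : ∀ n → 4 * n ≤ p * p → n * (2 * q * (2 * q)) ≤ L * L + 2 * (q * R)
    large n 4n≤p² = begin
      n * (2 * q * (2 * q))                    ≡⟨ regroup n q ⟩
      4 * n * (q * q)                          ≤⟨ ℕ.*-monoˡ-≤ (q * q) 4n≤p² ⟩
      p * p * (q * q)                          ≡⟨ swap p q ⟩
      q * p * (q * p)                          ≡⟨ cong (λ t → t * t) L+1≡ ⟨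
      suc L * suc L                            ≡⟨ multiply-out L ⟩
      L * L + 2 * L + 1                        ≤⟨ ℕ.+-monoʳ-≤ (L * L + 2 * L) 1≤4h ⟩
      L * L + 2 * L + 2 * (2 * h)              ≡⟨ factor L h ⟩
      L * L + 2 * (1 * R)                      ≤⟨ ℕ.+-monoʳ-≤ (L * L) (ℕ.*-monoʳ-≤ 2 (ℕ.*-monoˡ-≤ R (ℕ.<⇒≤ 1<q))) ⟩
      L * L + 2 * (q * R)                      ∎
      where
      open ℕ.≤-Reasoning
      1≤4h : 1 ≤ 2 * (2 * h)
      1≤4h = ℕ.≤-trans (ℕ.<⇒≤ 1<q) (ℕ.≤-trans (ℕ.m≤m+n q (suc m))
        (ℕ.≤-trans (ℕ.m≤n*m h 2) (ℕ.m≤n*m (2 * h) 2)))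
      regroup : ∀ n q → n * (2 * q * (2 * q)) ≡ 4 * n * (q * q)
      regroup = ℕ.solve-∀
      swap : ∀ p q → p * p * (q * q) ≡ q * p * (q * p)
      swap = ℕ.solve-∀
      multiply-out : ∀ L → (1 + L) * (1 + L) ≡ L * L + 2 * L + 1
      multiply-out = ℕ.solve-∀
      factor : ∀ L h → L * L + 2 * L + 2 * (2 * h) ≡ L * L + 2 * (1 * (L + 2 * h))
      factor = ℕ.solve-∀

    module _ (m3 : PowerOf3 m) {B} (T : Trapped (L * L + 2 * (q * R)) (2 * q) B) where
      private module W = Window q L R h q≤L low top

      q∣L+1 : q ∣ suc L
      q∣L+1 = subst (q ∣_) (sym L+1≡) (ℕ.m∣m*n p)

      m∣L+1 : m ∣ suc L
      m∣L+1 = ℕ.∣-trans m∣q q∣L+1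

      m+1∣L+1 : suc m ∣ suc L
      m+1∣L+1 = ℕ.∣-trans m+1∣q q∣L+1

      index-∣ : ∀ {i} → B (L + 2 * i) → q ∣ 2 * (i * (L + i))
      index-∣ {i} Bi = let s , _ , _ , _ , red = W.next-index T {i} Bi in
        reduced⇒∣ {q} {L} {R} {i} s red

      m∣ : ∀ n → B (L + 2 * suc n) → (m ∣ suc n) ⊎ (m ∣ n)
      m∣ n Bi = ∣2[n+1]n m3 (∣2[n+1][L+n+1] n m∣L+1 (ℕ.∣-trans m∣q (index-∣ {suc n} Bi)))

      m+1∣ : ∀ n → B (L + 2 * suc n) → suc m ∣ 2 * (suc n * n)
      m+1∣ n Bi = ∣2[n+1][L+n+1] n m+1∣L+1 (ℕ.∣-trans m+1∣q (index-∣ {suc n} Bi))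

      m+1∤4 : ¬ suc m ∣ 4
      m+1∤4 m+1∣4 = ℕ.<⇒≱ (s≤s (s≤s 2<p)) (ℕ.∣⇒≤ m+1∣4)

      -- Modulo `m + 1`, `m` is -1 and `p` is -2, so the product is 4. The same residue excludes the
      -- indices `m`, `q + m` and `2m + 1`.
      m+1∤2mp : ¬ suc m ∣ 2 * (suc p * p)
      m+1∤2mp d = m+1∤4 (ℕ.∣m+n∣m⇒∣n (subst (suc m ∣_) (eq p) (ℕ.∣m∣n⇒∣m+n d (ℕ.m∣m*n 2))) (ℕ.m∣m*n (2 * p)))
        where
        eq : ∀ p → 2 * ((1 + p) * p) + (2 + p) * 2 ≡ (2 + p) * (2 * p) + 4
        eq = ℕ.solve-∀

      ¬B[m] : ¬ B (L + 2 * m)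
      ¬B[m] Bi = m+1∤2mp (m+1∣ p Bi)

      ¬B[q+m] : ¬ B (L + 2 * suc (q + p))
      ¬B[q+m] Bi = m+1∤2mp (ℕ.∣m+n∣m⇒∣n (subst (suc m ∣_) (eq q p) (m+1∣ (q + p) Bi))
        (ℕ.∣-trans m+1∣q (ℕ.m∣m*n (2 * (q + p) + 2 * (1 + p)))))
        where
        eq : ∀ q p → 2 * ((1 + (q + p)) * (q + p)) ≡ q * (2 * (q + p) + 2 * (1 + p)) + 2 * ((1 + p) * p)
        eq = ℕ.solve-∀

      ¬B[2m+1] : ¬ B (L + 2 * suc (2 * m))
      ¬B[2m+1] Bi = m+1∤4 (ℕ.∣m+n∣m⇒∣n (subst (suc m ∣_) (eq m) (ℕ.∣m∣n⇒∣m+n (m+1∣ (2 * m) Bi) (ℕ.m∣m*n 4)))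
        (ℕ.m∣m*n (8 * m)))
        where
        eq : ∀ m → 2 * ((1 + 2 * m) * (2 * m)) + (1 + m) * 4 ≡ (1 + m) * (8 * m) + 4
        eq = ℕ.solve-∀

      -- Here the obstruction is modulo `m`, which would divide `q + 2` or `q + 1`, hence 2 or 1.
      ¬B[q+2] : ¬ B (L + 2 * suc (q + 1))
      ¬B[q+2] Bi = [ (λ d → m∤ 2 2<m (ℕ.∣m+n∣m⇒∣n (subst (m ∣_) (sym (ℕ.+-suc q 1)) d) m∣q))
                   , (λ d → m∤ 1 (ℕ.<-trans (ℕ.n<1+n 1) 2<m) (ℕ.∣m+n∣m⇒∣n d m∣q)) ]′ (m∣ (q + 1) Bi)
        where
        2<m : 2 < m
        2<m = ℕ.<-trans 2<p (ℕ.n<1+n p)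
        m∤ : ∀ n .{{_ : NonZero n}} → n < m → ¬ m ∣ n
        m∤ n n<m d = ℕ.<⇒≱ n<m (ℕ.∣⇒≤ d)

      cancel-q : ∀ {n j} → q * (2 * n) + q * (L + 2 * j) ≡ q * R → n + j ≡ h
      cancel-q {n} {j} eq = ℕ.*-cancelˡ-≡ _ _ 2 (ℕ.+-cancelˡ-≡ L _ _ (ℕ.*-cancelˡ-≡ _ _ q
        (trans (sym (gather q n L j)) eq)))
        where
        gather : ∀ q n L j → q * (2 * n) + q * (L + 2 * j) ≡ q * (L + 2 * (n + j))
        gather = ℕ.solve-∀

      -- Index 1 passes both congruences, but its image does not: `2(L + 1) = 2qp` gives
      -- `p + j = h`, so `j = q + 2`.
      ¬B[1]⁻ : ∀ {j} → B (L + 2 * j) → ¬ Reduced q L R 1 Sign.- (L + 2 * j)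
      ¬B[1]⁻ {j} Bj eq = ¬B[q+2] (subst (λ t → B (L + 2 * t)) j≡ Bj)
        where
        double : 2 * (1 * (L + 1)) ≡ q * (2 * p)
        double = trans (one L) (trans (cong (2 *_) L+1≡) (swap q p))
          where
          one : ∀ L → 2 * (1 * (L + 1)) ≡ 2 * (1 + L)
          one = ℕ.solve-∀
          swap : ∀ q p → 2 * (q * p) ≡ q * (2 * p)
          swap = ℕ.solve-∀
        j≡ : j ≡ suc (q + 1)
        j≡ = ℕ.+-cancelˡ-≡ p _ _ (trans (cancel-q {p} {j} (trans (cong (_+ q * (L + 2 * j)) (sym double)) eq)) (split q p))
          where
          split : ∀ q p → q + (2 + p) ≡ p + (1 + (q + 1))
          split = ℕ.solve-∀

      -- Again the image is at fault: `2(m + 1)(L + m + 1) = 2qm²` gives `m² + j = (m + 1)²`, so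
      -- `j = 2m + 1`.
      ¬B[m+1]⁻ : ∀ {j} → B (L + 2 * j) → ¬ Reduced q L R (suc m) Sign.- (L + 2 * j)
      ¬B[m+1]⁻ {j} Bj eq = ¬B[2m+1] (subst (λ t → B (L + 2 * t)) j≡ Bj)
        where
        double : 2 * (suc m * (L + suc m)) ≡ q * (2 * (m * m))
        double = trans (cong (λ t → 2 * (suc m * t)) (trans (ℕ.+-suc L m) (cong (_+ m) L+1≡))) (swap q≡)
          where
          swap : ∀ {q} → q ≡ (1 + p) * (2 + p) →
            2 * ((2 + p) * (q * p + (1 + p))) ≡ q * (2 * ((1 + p) * (1 + p)))
          swap refl = lemma p
            where
            lemma : ∀ p → 2 * ((2 + p) * ((1 + p) * (2 + p) * p + (1 + p)))
                        ≡ (1 + p) * (2 + p) * (2 * ((1 + p) * (1 + p)))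
            lemma = ℕ.solve-∀
        j≡ : j ≡ suc (2 * m)
        j≡ = ℕ.+-cancelˡ-≡ (m * m) _ _
          (trans (cancel-q {m * m} {j} (trans (cong (_+ q * (L + 2 * j)) (sym double)) eq))
          (trans (cong (_+ suc m) q≡) (split m)))
          where
          split : ∀ m → m * (1 + m) + (1 + m) ≡ m * m + (1 + 2 * m)
          split = ℕ.solve-∀

      -- A minus sign bounds `2i(L + i)` by `2qh`, so `far` gives `i < 2m`. Of the candidates 0, 1,
      -- `m`, `m + 1` only 0 survives.
      negative : ∀ {i j} → B (L + 2 * i) → B (L + 2 * j) → Reduced q L R i Sign.- (L + 2 * j) → i ≡ 0
      negative {i} {j} Bi Bj eq =
        go i Bi eq (small-index {i = i} m3 m∣L+1 (ℕ.∣-trans m∣q (index-∣ {i} Bi)) (ℕ.≰⇒> 2m≰i))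
        where
        open ℕ.≤-Reasoning
        2m≰i : ¬ 2 * m ≤ i
        2m≰i 2m≤i = ℕ.<⇒≱ far (begin
          2 * (2 * m * (L + 2 * m))   ≤⟨ ℕ.*-monoʳ-≤ 2 (ℕ.*-mono-≤ 2m≤i (ℕ.+-monoʳ-≤ L 2m≤i)) ⟩
          2 * (i * (L + i))           ≤⟨ ℕ.+-cancelʳ-≤ (q * L) _ _ (begin
            2 * (i * (L + i)) + q * L             ≤⟨ ℕ.+-monoʳ-≤ (2 * (i * (L + i))) (ℕ.*-monoʳ-≤ q (ℕ.m≤m+n L (2 * j))) ⟩
            2 * (i * (L + i)) + q * (L + 2 * j)   ≡⟨ eq ⟩
            q * (L + 2 * h)                       ≡⟨ ℕ.*-distribˡ-+ q L (2 * h) ⟩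
            q * L + q * (2 * h)                   ≡⟨ ℕ.+-comm (q * L) (q * (2 * h)) ⟩
            q * (2 * h) + q * L                   ∎) ⟩
          q * (2 * h)                 ∎)
        go : ∀ i → B (L + 2 * i) → Reduced q L R i Sign.- (L + 2 * j) →
             i ≡ 0 ⊎ i ≡ 1 ⊎ i ≡ m ⊎ i ≡ suc m → i ≡ 0
        go _ Bi eq (inj₁ i≡0)                = i≡0
        go _ Bi eq (inj₂ (inj₁ refl))        = ⊥-elim (¬B[1]⁻ {j} Bj eq)
        go _ Bi eq (inj₂ (inj₂ (inj₁ refl))) = ⊥-elim (¬B[m] Bi)
        go _ Bi eq (inj₂ (inj₂ (inj₂ refl))) = ⊥-elim (¬B[m+1]⁻ {j} Bj eq)

      -- A plus sign needs `i(L + i) ≥ q(L + h)`, hence `i > q`. For `i = q + 1 + d` with `d ≤ m`,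
      -- `m` divides `d` or `d + 1`; the case `d = m − 1` is index `q + m`, already excluded.
      positive : ∀ {i j} → i ≤ h → B (L + 2 * i) → Reduced q L R i Sign.+ (L + 2 * j) → i ≡ suc q ⊎ i ≡ h
      positive {i} {j} i≤h Bi eq = beyond (ℕ.m≤n⇒∃[o]m+o≡n (ℕ.≰⇒> i≰q)) i≤h Bi
        where
        open ℕ.≤-Reasoning
        pull : ∀ q L → 2 * (q * (L + q)) ≡ q * (2 * L + 2 * q)
        pull = ℕ.solve-∀
        regroup : ∀ L h → 2 * L + 2 * h ≡ L + 2 * h + L
        regroup = ℕ.solve-∀
        i≰q : ¬ i ≤ q
        i≰q i≤q = ℕ.<⇒≢ (begin-strict
          2 * (i * (L + i))      ≤⟨ ℕ.*-monoʳ-≤ 2 (ℕ.*-mono-≤ i≤q (ℕ.+-monoʳ-≤ L i≤q)) ⟩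
          2 * (q * (L + q))      ≡⟨ pull q L ⟩
          q * (2 * L + 2 * q)    <⟨ ℕ.*-monoʳ-< q (ℕ.+-monoʳ-< (2 * L) (ℕ.*-monoʳ-< 2 (ℕ.m<m+n q ℕ.z<s))) ⟩
          q * (2 * L + 2 * h)    ≡⟨ cong (q *_) (regroup L h) ⟩
          q * (R + L)            ≤⟨ ℕ.*-monoʳ-≤ q (ℕ.+-monoʳ-≤ R (ℕ.m≤m+n L (2 * j))) ⟩
          q * (R + (L + 2 * j))  ∎) eq
        m+1<2m : suc m < 2 * m
        m+1<2m = subst (_< 2 * m) (ℕ.+-comm m 1) (ℕ.+-monoʳ-< m (ℕ.<-≤-trans (ℕ.<-trans (ℕ.n<1+n 1) 2<p)
          (ℕ.≤-trans (ℕ.n≤1+n p) (ℕ.m≤m+n m 0))))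
        beyond : ∀ {i} → (∃ λ d → suc q + d ≡ i) → i ≤ h → B (L + 2 * i) → i ≡ suc q ⊎ i ≡ h
        beyond (d , refl) i≤h Bi =
          [ (λ m∣q+d+1 → on-suc (small-multiple
                (ℕ.∣m+n∣m⇒∣n (subst (m ∣_) (sym (ℕ.+-suc q d)) m∣q+d+1) m∣q) (ℕ.≤-<-trans (s≤s d≤m) m+1<2m)) Bi)
          , (λ m∣q+d → on-d (small-multiple
                (ℕ.∣m+n∣m⇒∣n m∣q+d m∣q) (ℕ.≤-<-trans d≤m (ℕ.<-trans (ℕ.n<1+n m) m+1<2m))))
          ]′ (m∣ (q + d) Bi)
          where
          d≤m : d ≤ m
          d≤m = ℕ.+-cancelˡ-≤ (suc q) _ _ (subst (suc q + d ≤_) (ℕ.+-suc q m) i≤h)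
          on-suc : ∀ {d} → suc d ≡ 0 ⊎ suc d ≡ m → B (L + 2 * suc (q + d)) →
                   suc q + d ≡ suc q ⊎ suc q + d ≡ h
          on-suc (inj₂ refl) Bi = ⊥-elim (¬B[q+m] Bi)
          on-d : ∀ {d} → d ≡ 0 ⊎ d ≡ m → suc q + d ≡ suc q ⊎ suc q + d ≡ h
          on-d (inj₁ refl) = inj₁ (ℕ.+-identityʳ (suc q))
          on-d (inj₂ refl) = inj₂ (sym (ℕ.+-suc q m))

      cubic-index : ∀ {i} → B (L + 2 * i) → i ≤ h → i ≡ 0 ⊎ i ≡ suc q ⊎ i ≡ h
      cubic-index {i} Bi i≤h = go (W.next-index T {i} Bi)
        where
        go : (∃ λ s → ∃ λ j → j ≤ h × B (L + 2 * j) × Reduced q L R i s (L + 2 * j)) → _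
        go (Sign.- , j , _ , Bj , red) = inj₁ (negative {i} {j} Bi Bj red)
        go (Sign.+ , j , _ , _  , red) = inj₂ (positive {i} {j} i≤h Bi red)

-- The six families.

infinite4⟨1,1⟩ : Infinite (λ c → PrePer c ≅ G4⟨1,1⟩)
infinite4⟨1,1⟩ =
  infinite-family symmetric4⟨1,1⟩ q L R h q≢0 q≤L low top large idx idx-injective steps complete
  where
  -- With `l = n + 2` this is c = -l(l + 1), whose fixed points are -l and l + 1; as -L is fixed,
  -- `R = L`.
  q L R h : ℕ → ℕ
  q n = 1
  L n = 4 + 2 * n
  R n = 4 + 2 * n
  h n = 1

  q≢0 : ∀ n → NonZero (q n)
  q≢0 n = _

  q≤L : ∀ n → q n ≤ L n
  q≤L n = ≤-by (3 + 2 * n) (eq n)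
    where
    eq : ∀ n → 1 + (3 + 2 * n)
         ≡ 4 + 2 * n
    eq = ℕ.solve-∀

  low : ∀ n → q n * (L n + 2 * h n) + 2 < q n * R n + 2 * L n
  low n = <-by (3 + 4 * n) (eq n)
    where
    eq : ∀ n → 1 + (1 * ((4 + 2 * n) + 2 * 1) + 2) + (3 + 4 * n)
         ≡ 1 * (4 + 2 * n) + 2 * (4 + 2 * n)
    eq = ℕ.solve-∀

  top : ∀ n → q n * (R n + (L n + 2 * suc (h n))) < 2 * (suc (h n) * (L n + suc (h n)))
  top n = <-by (11 + 4 * n) (eq n)
    where
    eq : ∀ n → 1 + (1 * ((4 + 2 * n) + ((4 + 2 * n) + 2 * 2))) + (11 + 4 * n)
         ≡ 2 * (2 * ((4 + 2 * n) + 2))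
    eq = ℕ.solve-∀

  large : ∀ n → n * (2 * q n * (2 * q n)) ≤ L n * L n + 2 * (q n * R n)
  large n = ≤-by (24 + 16 * n + 4 * (n * n)) (eq n)
    where
    eq : ∀ n → n * (2 * 1 * (2 * 1)) + (24 + 16 * n + 4 * (n * n))
         ≡ (4 + 2 * n) * (4 + 2 * n) + 2 * (1 * (4 + 2 * n))
    eq = ℕ.solve-∀

  idx : ℕ → Fin 2 → ℕ
  idx n 0F = 0
  idx n 1F = 1

  idx-injective : ∀ n {i j} → idx n i ≡ idx n j → i ≡ j
  idx-injective n {0F} {0F} eq = refl
  idx-injective n {0F} {1F} ()
  idx-injective n {1F} {0F} ()
  idx-injective n {1F} {1F} eq = refl

  module Steps where
    eq0 : ∀ n → 2 * (0 * ((4 + 2 * n) + 0)) + 1 * ((4 + 2 * n) + 2 * 0) ≡ 1 * (4 + 2 * n)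
    eq0 = ℕ.solve-∀
    eq1 : ∀ n → 2 * (1 * ((4 + 2 * n) + 1)) ≡ 1 * ((4 + 2 * n) + ((4 + 2 * n) + 2 * 1))
    eq1 = ℕ.solve-∀

  steps : ∀ n i → let s , j = Symmetric.next symmetric4⟨1,1⟩ i in
          Reduced (q n) (L n) (R n) (idx n i) s (L n + 2 * idx n j)
  steps n 0F = Steps.eq0 n
  steps n 1F = Steps.eq1 n

  complete : ∀ n → PowerOf3 (4 + n) →
    ∀ {B} → Trapped (L n * L n + 2 * (q n * R n)) (2 * q n) B →
    ∀ {i} → B (L n + 2 * i) → i ≤ h n → ∃ λ j → i ≡ idx n j
  complete n n3 T {0} Bi _ = 0F , refl
  complete n n3 T {1} Bi _ = 1F , refl
  complete n n3 T {suc (suc _)} Bi (s≤s ())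

infinite4⟨2⟩ : Infinite (λ c → PrePer c ≅ G4⟨2⟩)
infinite4⟨2⟩ =
  infinite-family symmetric4⟨2⟩ q L R h q≢0 q≤L low top large idx idx-injective steps complete
  where
  -- With `l = n + 2` this is c = -(l² + l + 1), with 2-cycle l, -(l + 1); hence `R = L + 2`.
  q L R h : ℕ → ℕ
  q n = 1
  L n = 4 + 2 * n
  R n = 6 + 2 * n
  h n = 1

  q≢0 : ∀ n → NonZero (q n)
  q≢0 n = _

  q≤L : ∀ n → q n ≤ L n
  q≤L n = ≤-by (3 + 2 * n) (eq n)
    where
    eq : ∀ n → 1 + (3 + 2 * n)
         ≡ 4 + 2 * n
    eq = ℕ.solve-∀

  low : ∀ n → q n * (L n + 2 * h n) + 2 < q n * R n + 2 * L n
  low n = <-by (5 + 4 * n) (eq n)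
    where
    eq : ∀ n → 1 + (1 * ((4 + 2 * n) + 2 * 1) + 2) + (5 + 4 * n)
         ≡ 1 * (6 + 2 * n) + 2 * (4 + 2 * n)
    eq = ℕ.solve-∀

  top : ∀ n → q n * (R n + (L n + 2 * suc (h n))) < 2 * (suc (h n) * (L n + suc (h n)))
  top n = <-by (9 + 4 * n) (eq n)
    where
    eq : ∀ n → 1 + (1 * ((6 + 2 * n) + ((4 + 2 * n) + 2 * 2))) + (9 + 4 * n)
         ≡ 2 * (2 * ((4 + 2 * n) + 2))
    eq = ℕ.solve-∀

  large : ∀ n → n * (2 * q n * (2 * q n)) ≤ L n * L n + 2 * (q n * R n)
  large n = ≤-by (28 + 16 * n + 4 * (n * n)) (eq n)
    where
    eq : ∀ n → n * (2 * 1 * (2 * 1)) + (28 + 16 * n + 4 * (n * n))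
         ≡ (4 + 2 * n) * (4 + 2 * n) + 2 * (1 * (6 + 2 * n))
    eq = ℕ.solve-∀

  idx : ℕ → Fin 2 → ℕ
  idx n 0F = 0
  idx n 1F = 1

  idx-injective : ∀ n {i j} → idx n i ≡ idx n j → i ≡ j
  idx-injective n {0F} {0F} eq = refl
  idx-injective n {0F} {1F} ()
  idx-injective n {1F} {0F} ()
  idx-injective n {1F} {1F} eq = refl

  module Steps where
    eq0 : ∀ n → 2 * (0 * ((4 + 2 * n) + 0)) + 1 * ((4 + 2 * n) + 2 * 1) ≡ 1 * (6 + 2 * n)
    eq0 = ℕ.solve-∀
    eq1 : ∀ n → 2 * (1 * ((4 + 2 * n) + 1)) ≡ 1 * ((6 + 2 * n) + ((4 + 2 * n) + 2 * 0))
    eq1 = ℕ.solve-∀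

  steps : ∀ n i → let s , j = Symmetric.next symmetric4⟨2⟩ i in
          Reduced (q n) (L n) (R n) (idx n i) s (L n + 2 * idx n j)
  steps n 0F = Steps.eq0 n
  steps n 1F = Steps.eq1 n

  complete : ∀ n → PowerOf3 (4 + n) →
    ∀ {B} → Trapped (L n * L n + 2 * (q n * R n)) (2 * q n) B →
    ∀ {i} → B (L n + 2 * i) → i ≤ h n → ∃ λ j → i ≡ idx n j
  complete n n3 T {0} Bi _ = 0F , refl
  complete n n3 T {1} Bi _ = 1F , refl
  complete n n3 T {suc (suc _)} Bi (s≤s ())

-- The fixed points are (m + 1)²/2m and -(m² + 1)/2m, and ±(m² - 1)/2m map to -(m + 1)²/2m.
infinite6⟨1,1⟩ : Infinite (λ c → PrePer c ≅ G6⟨1,1⟩)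
infinite6⟨1,1⟩ =
  infinite-family symmetric6⟨1,1⟩ q L R h q≢0 q≤L low top large idx idx-injective steps complete
  where
  -- With m = 4 + n: L = m² − 1 and R = (m + 1)².
  q L R h : ℕ → ℕ
  q n = 4 + n
  L n = 15 + 8 * n + n * n
  R n = 25 + 10 * n + n * n
  h n = 5 + n

  q≢0 : ∀ n → NonZero (q n)
  q≢0 n = _

  q≤L : ∀ n → q n ≤ L n
  q≤L n = ≤-by (11 + 7 * n + n * n) (eq n)
    where
    eq : ∀ n → (4 + n) + (11 + 7 * n + n * n)
         ≡ 15 + 8 * n + n * n
    eq = ℕ.solve-∀

  low : ∀ n → q n * (L n + 2 * h n) + 2 < q n * R n + 2 * L n
  low n = <-by (27 + 16 * n + 2 * (n * n)) (eq n)
    where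
    eq : ∀ n →
      1 + ((4 + n) * ((15 + 8 * n + n * n) + 2 * (5 + n)) + 2)
      + (27 + 16 * n + 2 * (n * n))
         ≡ (4 + n) * (25 + 10 * n + n * n) + 2 * (15 + 8 * n + n * n)
    eq = ℕ.solve-∀

  top : ∀ n → q n * (R n + (L n + 2 * suc (h n))) < 2 * (suc (h n) * (L n + suc (h n)))
  top n = <-by (43 + 18 * n + 2 * (n * n)) (eq n)
    where
    eq : ∀ n →
      1 + ((4 + n) * ((25 + 10 * n + n * n) + ((15 + 8 * n + n * n) + 2 * (1 + (5 + n)))))
      + (43 + 18 * n + 2 * (n * n))
         ≡ 2 * ((1 + (5 + n)) * ((15 + 8 * n + n * n) + (1 + (5 + n))))
    eq = ℕ.solve-∀

  large : ∀ n → n * (2 * q n * (2 * q n)) ≤ L n * L n + 2 * (q n * R n)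
  large n = ≤-by (425 + 306 * n + 90 * (n * n) + 14 * (n * n * n) + n * n * n * n) (eq n)
    where
    eq : ∀ n →
      n * (2 * (4 + n) * (2 * (4 + n)))
      + (425 + 306 * n + 90 * (n * n) + 14 * (n * n * n) + n * n * n * n)
         ≡ (15 + 8 * n + n * n) * (15 + 8 * n + n * n) + 2 * ((4 + n) * (25 + 10 * n + n * n))
    eq = ℕ.solve-∀

  idx : ℕ → Fin 3 → ℕ
  idx n 0F = 0
  idx n 1F = 1
  idx n 2F = 5 + n

  idx-injective : ∀ n {i j} → idx n i ≡ idx n j → i ≡ j
  idx-injective n {0F} {0F} eq = refl
  idx-injective n {0F} {1F} ()
  idx-injective n {0F} {2F} ()
  idx-injective n {1F} {0F} ()
  idx-injective n {1F} {1F} eq = refl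
  idx-injective n {1F} {2F} ()
  idx-injective n {2F} {0F} ()
  idx-injective n {2F} {1F} ()
  idx-injective n {2F} {2F} eq = refl

  module Steps where
    eq0 : ∀ n →
      2 * (0 * ((15 + 8 * n + n * n) + 0)) + (4 + n) * ((15 + 8 * n + n * n) + 2 * (5 + n))
      ≡ (4 + n) * (25 + 10 * n + n * n)
    eq0 = ℕ.solve-∀
    eq1 : ∀ n →
      2 * (1 * ((15 + 8 * n + n * n) + 1)) + (4 + n) * ((15 + 8 * n + n * n) + 2 * 1)
      ≡ (4 + n) * (25 + 10 * n + n * n)
    eq1 = ℕ.solve-∀
    eq2 : ∀ n →
      2 * ((5 + n) * ((15 + 8 * n + n * n) + (5 + n)))
      ≡ (4 + n) * ((25 + 10 * n + n * n) + ((15 + 8 * n + n * n) + 2 * (5 + n)))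
    eq2 = ℕ.solve-∀

  steps : ∀ n i → let s , j = Symmetric.next symmetric6⟨1,1⟩ i in
          Reduced (q n) (L n) (R n) (idx n i) s (L n + 2 * idx n j)
  steps n 0F = Steps.eq0 n
  steps n 1F = Steps.eq1 n
  steps n 2F = Steps.eq2 n

  complete : ∀ n → PowerOf3 (4 + n) →
    ∀ {B} → Trapped (L n * L n + 2 * (q n * R n)) (2 * q n) B →
    ∀ {i} → B (L n + 2 * i) → i ≤ h n → ∃ λ j → i ≡ idx n j
  complete n n3 {B} T {i} Bi i≤h = go
    (power-index {q n} {L n} {R n} {h n} (q≤L n) (low n) (top n) T n3
      (ℕ.divides (4 + n) (L+1 n)) (h<2q n) {i} Bi i≤h)
    where
    L+1 : ∀ n → 1 + (15 + 8 * n + n * n) ≡ (4 + n) * (4 + n)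
    L+1 = ℕ.solve-∀
    h<2q : ∀ n → h n < 2 * q n
    h<2q n = <-by (2 + n) (eq n)
      where
      eq : ∀ n → 1 + (5 + n) + (2 + n) ≡ 2 * (4 + n)
      eq = ℕ.solve-∀
    R< : ∀ n → R n < 2 * (L n + q n)
    R< n = <-by (12 + 8 * n + n * n) (eq n)
      where
      eq : ∀ n → 1 + (25 + 10 * n + n * n) + (12 + 8 * n + n * n)
           ≡ 2 * (15 + 8 * n + n * n + (4 + n))
      eq = ℕ.solve-∀
    <R+L : ∀ n → 2 * (L n + q n) < R n + L n
    <R+L n = <-by 1 (eq n)
      where
      eq : ∀ n → 1 + 2 * (15 + 8 * n + n * n + (4 + n)) + 1
           ≡ 25 + 10 * n + n * n + (15 + 8 * n + n * n)
      eq = ℕ.solve-∀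
    go : i ≡ 0 ⊎ i ≡ 1 ⊎ i ≡ q n ⊎ i ≡ suc (q n) → ∃ λ j → i ≡ idx n j
    go (inj₁ i≡)               = 0F , i≡
    go (inj₂ (inj₁ i≡))        = 1F , i≡
    -- Index `m` passes the congruence, but its image would be `L − 2`, just below the window.
    go (inj₂ (inj₂ (inj₁ i≡))) = ⊥-elim
      (index≢q {q n} {L n} {R n} {h n} (q≤L n) (low n) (top n) T (R< n) (<R+L n)
        (subst (λ t → B (L n + 2 * t)) i≡ Bi))
    go (inj₂ (inj₂ (inj₂ i≡))) = 2F , i≡

-- The 2-cycle is (m² - 1)/2m, -(m² + 2m - 1)/2m, and ±(m² + 1)/2m map to -(m² - 1)/2m.
infinite6⟨2⟩ : Infinite (λ c → PrePer c ≅ G6⟨2⟩)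
infinite6⟨2⟩ =
  infinite-family symmetric6⟨2⟩ q L R h q≢0 q≤L low top large idx idx-injective steps complete
  where
  -- With m = 4 + n: L = m² − 1 and R = m² + 2m − 1.
  q L R h : ℕ → ℕ
  q n = 4 + n
  L n = 15 + 8 * n + n * n
  R n = 23 + 10 * n + n * n
  h n = 4 + n

  q≢0 : ∀ n → NonZero (q n)
  q≢0 n = _

  q≤L : ∀ n → q n ≤ L n
  q≤L n = ≤-by (11 + 7 * n + n * n) (eq n)
    where
    eq : ∀ n → (4 + n) + (11 + 7 * n + n * n)
         ≡ 15 + 8 * n + n * n
    eq = ℕ.solve-∀

  low : ∀ n → q n * (L n + 2 * h n) + 2 < q n * R n + 2 * L n
  low n = <-by (27 + 16 * n + 2 * (n * n)) (eq n)
    where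
    eq : ∀ n →
      1 + ((4 + n) * ((15 + 8 * n + n * n) + 2 * (4 + n)) + 2)
      + (27 + 16 * n + 2 * (n * n))
         ≡ (4 + n) * (23 + 10 * n + n * n) + 2 * (15 + 8 * n + n * n)
    eq = ℕ.solve-∀

  top : ∀ n → q n * (R n + (L n + 2 * suc (h n))) < 2 * (suc (h n) * (L n + suc (h n)))
  top n = <-by (7 + 2 * n) (eq n)
    where
    eq : ∀ n →
      1 + ((4 + n) * ((23 + 10 * n + n * n) + ((15 + 8 * n + n * n) + 2 * (1 + (4 + n)))))
      + (7 + 2 * n)
         ≡ 2 * ((1 + (4 + n)) * ((15 + 8 * n + n * n) + (1 + (4 + n))))
    eq = ℕ.solve-∀

  large : ∀ n → n * (2 * q n * (2 * q n)) ≤ L n * L n + 2 * (q n * R n)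
  large n = ≤-by (409 + 302 * n + 90 * (n * n) + 14 * (n * n * n) + n * n * n * n) (eq n)
    where
    eq : ∀ n →
      n * (2 * (4 + n) * (2 * (4 + n)))
      + (409 + 302 * n + 90 * (n * n) + 14 * (n * n * n) + n * n * n * n)
         ≡ (15 + 8 * n + n * n) * (15 + 8 * n + n * n) + 2 * ((4 + n) * (23 + 10 * n + n * n))
    eq = ℕ.solve-∀

  idx : ℕ → Fin 3 → ℕ
  idx n 0F = 0
  idx n 1F = 1
  idx n 2F = 4 + n

  idx-injective : ∀ n {i j} → idx n i ≡ idx n j → i ≡ j
  idx-injective n {0F} {0F} eq = refl
  idx-injective n {0F} {1F} ()
  idx-injective n {0F} {2F} ()
  idx-injective n {1F} {0F} ()
  idx-injective n {1F} {1F} eq = refl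
  idx-injective n {1F} {2F} ()
  idx-injective n {2F} {0F} ()
  idx-injective n {2F} {1F} ()
  idx-injective n {2F} {2F} eq = refl

  module Steps where
    eq0 : ∀ n →
      2 * (0 * ((15 + 8 * n + n * n) + 0)) + (4 + n) * ((15 + 8 * n + n * n) + 2 * (4 + n))
      ≡ (4 + n) * (23 + 10 * n + n * n)
    eq0 = ℕ.solve-∀
    eq1 : ∀ n →
      2 * (1 * ((15 + 8 * n + n * n) + 1)) + (4 + n) * ((15 + 8 * n + n * n) + 2 * 0)
      ≡ (4 + n) * (23 + 10 * n + n * n)
    eq1 = ℕ.solve-∀
    eq2 : ∀ n →
      2 * ((4 + n) * ((15 + 8 * n + n * n) + (4 + n)))
      ≡ (4 + n) * ((23 + 10 * n + n * n) + ((15 + 8 * n + n * n) + 2 * 0))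
    eq2 = ℕ.solve-∀

  steps : ∀ n i → let s , j = Symmetric.next symmetric6⟨2⟩ i in
          Reduced (q n) (L n) (R n) (idx n i) s (L n + 2 * idx n j)
  steps n 0F = Steps.eq0 n
  steps n 1F = Steps.eq1 n
  steps n 2F = Steps.eq2 n

  complete : ∀ n → PowerOf3 (4 + n) →
    ∀ {B} → Trapped (L n * L n + 2 * (q n * R n)) (2 * q n) B →
    ∀ {i} → B (L n + 2 * i) → i ≤ h n → ∃ λ j → i ≡ idx n j
  complete n n3 T {i} Bi i≤h = go
    (power-index {q n} {L n} {R n} {h n} (q≤L n) (low n) (top n) T n3
      (ℕ.divides (4 + n) (L+1 n)) (ℕ.m<m+n (4 + n) ℕ.z<s) {i} Bi i≤h)
    where
    L+1 : ∀ n → 1 + (15 + 8 * n + n * n) ≡ (4 + n) * (4 + n)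
    L+1 = ℕ.solve-∀
    go : i ≡ 0 ⊎ i ≡ 1 ⊎ i ≡ q n ⊎ i ≡ suc (q n) → ∃ λ j → i ≡ idx n j
    go (inj₁ i≡)               = 0F , i≡
    go (inj₂ (inj₁ i≡))        = 1F , i≡
    go (inj₂ (inj₂ (inj₁ i≡))) = 2F , i≡
    go (inj₂ (inj₂ (inj₂ i≡))) = ⊥-elim (ℕ.<⇒≱ (ℕ.n<1+n (h n)) (subst (_≤ h n) i≡ i≤h))

-- All four candidates of `power-index` occur: 0 and `m` carry the 2-cycle, 1 and `m + 1` the fixed
-- points.
infinite8⟨2,1,1⟩ : Infinite (λ c → PrePer c ≅ G8⟨2,1,1⟩)
infinite8⟨2,1,1⟩ =
  infinite-family symmetric8⟨2,1,1⟩ q L R h q≢0 q≤L low top large idx idx-injective steps complete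
  where
  -- With m = 4 + n: L = m² − m − 1 and R = m² + m − 1.
  q L R h : ℕ → ℕ
  q n = 4 + n
  L n = 11 + 7 * n + n * n
  R n = 19 + 9 * n + n * n
  h n = 5 + n

  q≢0 : ∀ n → NonZero (q n)
  q≢0 n = _

  q≤L : ∀ n → q n ≤ L n
  q≤L n = ≤-by (7 + 6 * n + n * n) (eq n)
    where
    eq : ∀ n → (4 + n) + (7 + 6 * n + n * n)
         ≡ 11 + 7 * n + n * n
    eq = ℕ.solve-∀

  low : ∀ n → q n * (L n + 2 * h n) + 2 < q n * R n + 2 * L n
  low n = <-by (11 + 12 * n + 2 * (n * n)) (eq n)
    where
    eq : ∀ n →
      1 + ((4 + n) * ((11 + 7 * n + n * n) + 2 * (5 + n)) + 2)
      + (11 + 12 * n + 2 * (n * n))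
         ≡ (4 + n) * (19 + 9 * n + n * n) + 2 * (11 + 7 * n + n * n)
    eq = ℕ.solve-∀

  top : ∀ n → q n * (R n + (L n + 2 * suc (h n))) < 2 * (suc (h n) * (L n + suc (h n)))
  top n = <-by (35 + 16 * n + 2 * (n * n)) (eq n)
    where
    eq : ∀ n →
      1 + ((4 + n) * ((19 + 9 * n + n * n) + ((11 + 7 * n + n * n) + 2 * (1 + (5 + n)))))
      + (35 + 16 * n + 2 * (n * n))
         ≡ 2 * ((1 + (5 + n)) * ((11 + 7 * n + n * n) + (1 + (5 + n))))
    eq = ℕ.solve-∀

  large : ∀ n → n * (2 * q n * (2 * q n)) ≤ L n * L n + 2 * (q n * R n)
  large n = ≤-by (273 + 200 * n + 65 * (n * n) + 12 * (n * n * n) + n * n * n * n) (eq n)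
    where
    eq : ∀ n →
      n * (2 * (4 + n) * (2 * (4 + n)))
      + (273 + 200 * n + 65 * (n * n) + 12 * (n * n * n) + n * n * n * n)
         ≡ (11 + 7 * n + n * n) * (11 + 7 * n + n * n) + 2 * ((4 + n) * (19 + 9 * n + n * n))
    eq = ℕ.solve-∀

  idx : ℕ → Fin 4 → ℕ
  idx n 0F = 0
  idx n 1F = 1
  idx n 2F = 4 + n
  idx n 3F = 5 + n

  idx-injective : ∀ n {i j} → idx n i ≡ idx n j → i ≡ j
  idx-injective n {0F} {0F} eq = refl
  idx-injective n {0F} {1F} ()
  idx-injective n {0F} {2F} ()
  idx-injective n {0F} {3F} ()
  idx-injective n {1F} {0F} ()
  idx-injective n {1F} {1F} eq = refl
  idx-injective n {1F} {2F} ()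
  idx-injective n {1F} {3F} ()
  idx-injective n {2F} {0F} ()
  idx-injective n {2F} {1F} ()
  idx-injective n {2F} {2F} eq = refl
  idx-injective n {2F} {3F} ()
  idx-injective n {3F} {0F} ()
  idx-injective n {3F} {1F} ()
  idx-injective n {3F} {2F} ()
  idx-injective n {3F} {3F} eq = refl

  module Steps where
    eq0 : ∀ n →
      2 * (0 * ((11 + 7 * n + n * n) + 0)) + (4 + n) * ((11 + 7 * n + n * n) + 2 * (4 + n))
      ≡ (4 + n) * (19 + 9 * n + n * n)
    eq0 = ℕ.solve-∀
    eq1 : ∀ n →
      2 * (1 * ((11 + 7 * n + n * n) + 1)) + (4 + n) * ((11 + 7 * n + n * n) + 2 * 1)
      ≡ (4 + n) * (19 + 9 * n + n * n)
    eq1 = ℕ.solve-∀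
    eq2 : ∀ n →
      2 * ((4 + n) * ((11 + 7 * n + n * n) + (4 + n)))
      ≡ (4 + n) * ((19 + 9 * n + n * n) + ((11 + 7 * n + n * n) + 2 * 0))
    eq2 = ℕ.solve-∀
    eq3 : ∀ n →
      2 * ((5 + n) * ((11 + 7 * n + n * n) + (5 + n)))
      ≡ (4 + n) * ((19 + 9 * n + n * n) + ((11 + 7 * n + n * n) + 2 * (5 + n)))
    eq3 = ℕ.solve-∀

  steps : ∀ n i → let s , j = Symmetric.next symmetric8⟨2,1,1⟩ i in
          Reduced (q n) (L n) (R n) (idx n i) s (L n + 2 * idx n j)
  steps n 0F = Steps.eq0 n
  steps n 1F = Steps.eq1 n
  steps n 2F = Steps.eq2 n
  steps n 3F = Steps.eq3 n

  complete : ∀ n → PowerOf3 (4 + n) →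
    ∀ {B} → Trapped (L n * L n + 2 * (q n * R n)) (2 * q n) B →
    ∀ {i} → B (L n + 2 * i) → i ≤ h n → ∃ λ j → i ≡ idx n j
  complete n n3 T {i} Bi i≤h = go
    (power-index {q n} {L n} {R n} {h n} (q≤L n) (low n) (top n) T n3
      (ℕ.divides (3 + n) (L+1 n)) (h<2q n) {i} Bi i≤h)
    where
    L+1 : ∀ n → 1 + (11 + 7 * n + n * n) ≡ (3 + n) * (4 + n)
    L+1 = ℕ.solve-∀
    h<2q : ∀ n → h n < 2 * q n
    h<2q n = <-by (2 + n) (eq n)
      where
      eq : ∀ n → 1 + (5 + n) + (2 + n) ≡ 2 * (4 + n)
      eq = ℕ.solve-∀
    go : i ≡ 0 ⊎ i ≡ 1 ⊎ i ≡ q n ⊎ i ≡ suc (q n) → ∃ λ j → i ≡ idx n j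
    go (inj₁ i≡)               = 0F , i≡
    go (inj₂ (inj₁ i≡))        = 1F , i≡
    go (inj₂ (inj₂ (inj₁ i≡))) = 2F , i≡
    go (inj₂ (inj₂ (inj₂ i≡))) = 3F , i≡

infinite6⟨3⟩ : Infinite (λ c → PrePer c ≅ G6⟨3⟩)
infinite6⟨3⟩ =
  infinite-family symmetric6⟨3⟩ q L R h (λ n → Cubic.q≢0 (3 + n)) q≤L low top large
    idx idx-injective steps complete
  where
  q L R h : ℕ → ℕ
  q n = Cubic.q (3 + n)
  L n = Cubic.L (3 + n)
  R n = Cubic.R (3 + n)
  h n = Cubic.h (3 + n)

  2<p : ∀ {n} → 2 < 3 + n
  2<p = s≤s (s≤s (s≤s ℕ.z≤n))

  q≤L : ∀ n → q n ≤ L n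
  q≤L n = Cubic.Large.q≤L (3 + n) 2<p

  low : ∀ n → q n * (L n + 2 * h n) + 2 < q n * R n + 2 * L n
  low n = Cubic.Large.low (3 + n) 2<p

  top : ∀ n → q n * (R n + (L n + 2 * suc (h n))) < 2 * (suc (h n) * (L n + suc (h n)))
  top n = Cubic.Large.top (3 + n) 2<p

  large : ∀ n → n * (2 * q n * (2 * q n)) ≤ L n * L n + 2 * (q n * R n)
  large n = Cubic.Large.large (3 + n) 2<p n (≤-by (9 + 2 * n + n * n) (eq n))
    where
    eq : ∀ n → 4 * n + (9 + 2 * n + n * n) ≡ (3 + n) * (3 + n)
    eq = ℕ.solve-∀

  idx : ℕ → Fin 3 → ℕ
  idx n 0F = 0
  idx n 1F = suc (q n)
  idx n 2F = h n

  0≢h : ∀ n → 0 ≢ h n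
  0≢h n eq = ℕ.1+n≢0 (trans (sym (ℕ.+-suc (q n) (4 + n))) (sym eq))

  idx-injective : ∀ n {i j} → idx n i ≡ idx n j → i ≡ j
  idx-injective n {0F} {0F} eq = refl
  idx-injective n {0F} {1F} ()
  idx-injective n {0F} {2F} eq = ⊥-elim (0≢h n eq)
  idx-injective n {1F} {0F} ()
  idx-injective n {1F} {1F} eq = refl
  idx-injective n {1F} {2F} eq = ⊥-elim (Cubic.q+1≢h (3 + n) eq)
  idx-injective n {2F} {0F} eq = ⊥-elim (0≢h n (sym eq))
  idx-injective n {2F} {1F} eq = ⊥-elim (Cubic.q+1≢h (3 + n) (sym eq))
  idx-injective n {2F} {2F} eq = refl

  steps : ∀ n i → let s , j = Symmetric.next symmetric6⟨3⟩ i in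
          Reduced (q n) (L n) (R n) (idx n i) s (L n + 2 * idx n j)
  steps n 0F = Cubic.step₀ (3 + n)
  steps n 1F = Cubic.Large.step₁ (3 + n) 2<p
  steps n 2F = Cubic.Large.step₂ (3 + n) 2<p

  complete : ∀ n → PowerOf3 (4 + n) →
    ∀ {B} → Trapped (L n * L n + 2 * (q n * R n)) (2 * q n) B →
    ∀ {i} → B (L n + 2 * i) → i ≤ h n → ∃ λ j → i ≡ idx n j
  complete n n3 T {i} Bi i≤h = go (Cubic.Large.cubic-index (3 + n) 2<p n3 T {i} Bi i≤h)
    where
    go : i ≡ 0 ⊎ i ≡ suc (q n) ⊎ i ≡ h n → ∃ λ j → i ≡ idx n j
    go (inj₁ i≡)        = 0F , i≡
    go (inj₂ (inj₁ i≡)) = 1F , i≡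
    go (inj₂ (inj₂ i≡)) = 2F , i≡

theorem1p1 : All (λ G → Infinite (λ c → PrePer c ≅ G)) sixGraphs
theorem1p1 =
  infinite4⟨1,1⟩ ∷ infinite4⟨2⟩ ∷ infinite6⟨1,1⟩ ∷ infinite6⟨2⟩ ∷ infinite6⟨3⟩ ∷ infinite8⟨2,1,1⟩ ∷ []
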